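{- Let $g\ge2$. Every cone type of a nonidentity element of $\Gamma_g$ equals $\mathcal C(z)$ for some element $z$ represented by a nonempty subword of length at most $2g$ of a cyclic permutation of $[a_1,b_1]\cdots[a_g,b_g]$ or of its inverse $[b_g,a_g]\cdots[b_1,a_1]$; there are exactly $8g(2g-1)$ such cone types. Hence $\Gamma_g$ has exactly $8g(2g-1)+1$ cone types (including $\mathcal C(e)$).
   Context: $\Gamma_g=\langle a_1,\dots,a_g,b_1,\dots,b_g\mid [a_1,b_1]\cdots[a_g,b_g]\rangle$ with $[a,b]=aba^{ -1}b^{ -1}$, the fundamental group of a closed orientable surface of genus $g$, with symmetric generating set $\{a_i^{\pm1},b_i^{\pm1}\}$ and word length $|\cdot|$. The cone type of $x$ is $\mathcal C(x)=\{z\in\Gamma_g:\ |xz|=|x|+|z|\}$. -}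

module Defs where

open import Algebra.Bundles using (Group)
open import Data.Fin.Base using (Fin)
open import Data.List.Base using (List; []; _∷_; [_]; _++_; _∷ʳ_; map; concat; reverse; length; allFin)
open import Data.List.Properties using (++-assoc; ++-identityʳ; map-++; reverse-++; unfold-reverse; concat-++)
open import Data.List.Relation.Binary.Infix.Heterogeneous using (Infix)
open import Data.Nat.Base using (ℕ; _+_; _*_; _≤_)
open import Data.Product.Base using (Σ; ∃; ∃₂; _×_; _,_; proj₁; proj₂)
open import Data.Sign.Base using (Sign; opposite) renaming (+ to pos; - to neg)
open import Data.Sum.Base using (_⊎_)
open import Function.Bundles using (Bijection)
open import Level using (0ℓ; suc; _⊔_)
open import Relation.Binary.Bundles using (Setoid)
open import Relation.Binary.PropositionalEquality as ≡ using (_≡_; _≢_; cong; cong₂; module ≡-Reasoning)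
open import Relation.Unary using (Pred; _≐_)
open import Relation.Unary.Properties using (≐-refl; ≐-sym; ≐-trans)

-- (x , pos) is the generator x and (x , neg) its formal inverse.
Letter : Set → Set
Letter X = X × Sign

Word : Set → Set
Word X = List (Letter X)

module _ {X : Set} where

  invLetter : Letter X → Letter X
  invLetter (x , s) = x , opposite s

  inverse : Word X → Word X
  inverse w = reverse (map invLetter w)

  gen : X → Word X
  gen x = [ (x , pos) ]

  commutator : Word X → Word X → Word X
  commutator u v = u ++ v ++ inverse u ++ inverse v

  CyclicPermutation : Word X → Word X → Set
  CyclicPermutation w c = ∃₂ λ u v → w ≡ u ++ v × c ≡ v ++ u

  Subword : Word X → Word X → Set
  Subword = Infix _≡_

-- The group ⟨ X ∣ R ⟩.  Its elements are words, and equality of elements is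
-- the least congruence making the relators and all x x⁻¹ trivial.
module Presentation {X : Set} (R : Pred (Word X) 0ℓ) where

  infix 4 _≈_

  data _≈_ : Word X → Word X → Set where
    ≈-refl  : ∀ {u} → u ≈ u
    ≈-sym   : ∀ {u v} → u ≈ v → v ≈ u
    ≈-trans : ∀ {u v w} → u ≈ v → v ≈ w → u ≈ w
    ++-cong : ∀ {u u′ v v′} → u ≈ u′ → v ≈ v′ → u ++ v ≈ u′ ++ v′
    cancel  : ∀ x → x ∷ invLetter x ∷ [] ≈ []
    relator : ∀ {r} → R r → r ≈ []

  private
    ≡⇒≈ : ∀ {u v} → u ≡ v → u ≈ v
    ≡⇒≈ ≡.refl = ≈-refl

    cancel′ : ∀ x → invLetter x ∷ x ∷ [] ≈ []
    cancel′ (x , pos) = cancel (x , neg)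
    cancel′ (x , neg) = cancel (x , pos)

    nest : ∀ u v {w} → w ≈ [] → u ++ v ≈ [] → u ++ w ++ v ≈ []
    nest u v w≈ε uv≈ε = ≈-trans (++-cong (≈-refl {u}) (++-cong w≈ε (≈-refl {v}))) uv≈ε

    inverse-∷ : (x : Letter X) (u : Word X) → inverse (x ∷ u) ≡ inverse u ∷ʳ invLetter x
    inverse-∷ x u = unfold-reverse (invLetter x) (map invLetter u)

    inverseˡ : ∀ u → inverse u ++ u ≈ []
    inverseˡ []      = ≈-refl
    inverseˡ (x ∷ u) = ≈-trans
      (≡⇒≈ (≡.trans (cong (_++ (x ∷ u)) (inverse-∷ x u)) (++-assoc (inverse u) _ _)))
      (nest (inverse u) u (cancel′ x) (inverseˡ u))

    inverseʳ : ∀ u → u ++ inverse u ≈ []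
    inverseʳ []      = ≈-refl
    inverseʳ (x ∷ u) = ≈-trans
      (≡⇒≈ (cong (x ∷_) (≡.trans (cong (u ++_) (inverse-∷ x u)) (≡.sym (++-assoc u _ _)))))
      (≈-trans (++-cong (≈-refl {[ x ]}) (++-cong (inverseʳ u) ≈-refl)) (cancel x))

    inverse-cong : ∀ {u v} → u ≈ v → inverse u ≈ inverse v
    inverse-cong {u} {v} u≈v =
      ≈-trans (≡⇒≈ (≡.sym (++-identityʳ (inverse u))))
      (≈-trans (++-cong (≈-refl {inverse u}) (≈-sym (inverseʳ v)))
      (≈-trans (++-cong (≈-refl {inverse u}) (++-cong (≈-sym u≈v) (≈-refl {inverse v})))
      (≈-trans (≡⇒≈ (≡.sym (++-assoc (inverse u) u (inverse v))))
      (++-cong (inverseˡ u) (≈-refl {inverse v})))))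

  group : Group 0ℓ 0ℓ
  group = record
    { Carrier = Word X
    ; _≈_     = _≈_
    ; _∙_     = _++_
    ; ε       = []
    ; _⁻¹     = inverse
    ; isGroup = record
      { isMonoid = record
        { isSemigroup = record
          { isMagma = record
            { isEquivalence = record { refl = ≈-refl ; sym = ≈-sym ; trans = ≈-trans }
            ; ∙-cong        = ++-cong
            }
          ; assoc = λ u v w → ≡⇒≈ (++-assoc u v w)
          }
        ; identity = (λ u → ≈-refl) , (λ u → ≡⇒≈ (++-identityʳ u))
        }
      ; inverse = inverseˡ , inverseʳ
      ; ⁻¹-cong = inverse-cong
      }
    }

  open Group group using (Carrier; _∙_)

  -- The graph of the word length ∣_∣ for the generating set X ∪ X⁻¹.  It is a
  -- relation because the minimum is not computable for an arbitrary presentation.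
  HasLength : Carrier → ℕ → Set
  HasLength x n = (∃ λ w → w ≈ x × length w ≡ n) × (∀ w → w ≈ x → n ≤ length w)

  -- z ∈ ConeType x iff ∣ x ∙ z ∣ = ∣ x ∣ + ∣ z ∣.
  ConeType : Carrier → Pred Carrier 0ℓ
  ConeType x z = ∃₂ λ m n → HasLength x m × HasLength z n × HasLength (x ∙ z) (m + n)

  -- The set { ConeType x ∣ x ∈ Q }, whose members are subsets of the group
  -- compared extensionally.
  ConeTypesOf : Pred Carrier 0ℓ → Setoid (suc 0ℓ) 0ℓ
  ConeTypesOf Q = record
    { Carrier       = Σ (Pred Carrier 0ℓ) λ P → ∃ λ x → Q x × P ≐ ConeType x
    ; _≈_           = λ S T → proj₁ S ≐ proj₁ T
    ; isEquivalence = record { refl = ≐-refl ; sym = ≐-sym ; trans = ≐-trans }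
    }

HasCardinality : ∀ {c ℓ} → Setoid c ℓ → ℕ → Set (c ⊔ ℓ)
HasCardinality S n = Bijection (≡.setoid (Fin n)) S

data Generator (g : ℕ) : Set where
  a b : Fin g → Generator g

surfaceRelator : ∀ g → Word (Generator g)
surfaceRelator g = concat (map (λ i → commutator (gen (a i)) (gen (b i))) (allFin g))

-- The formal inverse of [a₁,b₁]⋯[a_g,b_g] is [b_g,a_g]⋯[b₁,a₁].
inverse-surfaceRelator : ∀ g → inverse (surfaceRelator g) ≡
  concat (map (λ i → commutator (gen (b i)) (gen (a i))) (reverse (allFin g)))
inverse-surfaceRelator g = go (allFin g)
  where
  open ≡-Reasoning

  ab ba : Fin g → Word (Generator g)
  ab i = commutator (gen (a i)) (gen (b i))
  ba i = commutator (gen (b i)) (gen (a i))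

  inverse-++ : (u v : Word (Generator g)) → inverse (u ++ v) ≡ inverse v ++ inverse u
  inverse-++ u v = ≡.trans (cong reverse (map-++ invLetter u v))
                           (reverse-++ (map invLetter u) (map invLetter v))

  go : ∀ is → inverse (concat (map ab is)) ≡ concat (map ba (reverse is))
  go []       = ≡.refl
  go (i ∷ is) = begin
    inverse (ab i ++ concat (map ab is))              ≡⟨ inverse-++ (ab i) (concat (map ab is)) ⟩
    inverse (concat (map ab is)) ++ ba i              ≡⟨ cong (_++ ba i) (go is) ⟩
    concat (map ba (reverse is)) ++ ba i              ≡⟨ concat-++ (map ba (reverse is)) [ ba i ] ⟩
    concat (map ba (reverse is) ++ map ba [ i ])      ≡⟨ cong concat (map-++ ba (reverse is) [ i ]) ⟨
    concat (map ba (reverse is ∷ʳ i))                 ≡⟨ cong (λ js → concat (map ba js)) (unfold-reverse i is) ⟨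
    concat (map ba (reverse (i ∷ is)))                ∎

module SurfaceGroup (g : ℕ) where

  open Presentation (_≡ surfaceRelator g) public using (HasLength; ConeType; ConeTypesOf)
    renaming (group to Γ)
  open Group Γ public using (Carrier; _≈_; ε)

  -- z is represented by a nonempty contiguous subword, of length at most 2g, of
  -- a cyclic permutation of the relator or of its inverse.
  ShortRelatorSubword : Pred Carrier 0ℓ
  ShortRelatorSubword z = ∃₂ λ s c →
      s ≈ z × s ≢ [] × length s ≤ 2 * g × Subword s c
    × (CyclicPermutation (surfaceRelator g) c ⊎ CyclicPermutation (inverse (surfaceRelator g)) c)

{-# OPTIONS --safe #-}
module Submission where

-- The Cayley complex is a tiling of the plane by 4g-gons, 4g at each vertex.
-- Grade its vertices by the distance to ε.  Every face has a bottom and a top,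
-- joined by two sides of length 2g, and what a geodesic to x says about the
-- continuations from x is only how many steps it has run along the side of a
-- face: along the left side, along the right side, or up to the top.  These
-- states form an automaton δ.
--
-- Its leftmost paths are taken as vertices, and right multiplication by a letter
-- is defined on them by recursion: it appends or deletes a letter, except at an
-- edge closing a face from the right, where the right side of the face is
-- exchanged with the left one and the multiplication recurs at the bottom.
-- This gives an action in which the relator is trivial (by induction on the
-- height, since unless x is the bottom of a face, that face has a lower vertex
-- next to x), so the group acts, and the length of an element is the height of
-- its vertex.  A cone type is then the language accepted from a state, and distinct
-- states accept distinct languages: the inverses of the last letters are the
-- letters rejected at once, and of two runs along the same side the longer one
-- reaches first a top, which rejects two letters.

open import Defs
open import Data.Nat.Base using (ℕ; _≤_; _+_; _*_; _∸_)
open import Data.Product.Base using (∃; _×_)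
open import Relation.Nullary using (¬_)
open import Relation.Unary using (_≐_; U)

open import Data.Bool.Base using (if_then_else_)
open import Data.Fin.Base using (Fin; zero; suc; toℕ; fromℕ<; fromℕ; inject₁)
import Data.Fin.Properties as Fin
open import Data.Fin.Relation.Unary.Top using (view; view-fromℕ; view-inject₁; ‵fromℕ; ‵inject₁)
open import Data.List.Base
  using (List; []; _∷_; [_]; _++_; _∷ʳ_; _ʳ++_; iterate; length; reverse; map; concat; tabulate; allFin)
open import Data.List.Properties
  using (length-ʳ++; length-iterate; length-reverse; unfold-reverse; reverse-++; ʳ++-ʳ++; ʳ++-defn;
         map-++; ++-assoc; ++-identityʳ; ∷-injective; tabulate-cong)
open import Data.List.Relation.Binary.Infix.Heterogeneous using (View; MkView; toView; fromView)
open import Data.List.Relation.Binary.Pointwise using (Pointwise-≡⇒≡; ≡⇒Pointwise-≡)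
open import Data.Maybe.Base using (Maybe; just; nothing)
open import Data.Maybe.Properties using (just-injective; ≡-dec)
open import Data.Nat.Base using (zero; suc; _<_; z≤n; s≤s)
open import Data.Nat.GeneralisedArithmetic using (fold; fold-+)
import Data.Nat.Properties as ℕ
open import Data.Nat.Tactic.RingSolver using (solve-∀)
open import Data.Product.Base using (∃₂; _,_; proj₁; proj₂)
open import Data.Product.Function.NonDependent.Propositional using (_×-↔_)
import Data.Product.Properties as Product
open import Data.Sign.Base using () renaming (+ to pos; - to neg)
import Data.Sign.Properties as Sign
open import Data.Sum.Base using (_⊎_; inj₁; inj₂)
open import Data.Sum.Function.Propositional using (_⊎-↔_)
open import Data.Unit.Base using (tt)
open import Function.Base using (_∘_; case_of_)
open import Function.Bundles using (_↔_; Inverse; Injection; mk↔ₛ′)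
open import Function.Properties.Inverse using (↔-refl; ↔-trans; Inverse⇒Injection)
open import Level using (0ℓ)
open import Relation.Binary.Definitions using (DecidableEquality)
open import Relation.Binary.PropositionalEquality
  using (_≡_; _≢_; refl; sym; trans; cong; cong₂; subst; subst₂; module ≡-Reasoning)
open import Relation.Nullary using (Dec; yes; no; does; contradiction)
open import Relation.Nullary.Decidable using (dec-true; dec-false; map′; _⊎-dec_; _×-dec_)
open import Relation.Unary using (Pred; _⊆_)
open import Relation.Unary.Properties using (≐-refl; ≐-sym; ≐-trans)

-- Iterates of a function

module _ {A : Set} (f : A → A) where

  fold-shift : ∀ x k → fold (f x) f k ≡ f (fold x f k)
  fold-shift x zero    = refl
  fold-shift x (suc k) = cong f (fold-shift x k)

  iterate-ʳ++ : ∀ x k ys → iterate f x (suc k) ʳ++ ys ≡ fold x f k ∷ (iterate f x k ʳ++ ys)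
  iterate-ʳ++ x zero    ys = refl
  iterate-ʳ++ x (suc k) ys = trans (iterate-ʳ++ (f x) k (x ∷ ys)) (cong (_∷ (iterate f (f x) k ʳ++ (x ∷ ys))) (fold-shift x k))

  length-iterate-ʳ++ : ∀ x k ys → length (iterate f x k ʳ++ ys) ≡ k + length ys
  length-iterate-ʳ++ x k ys = trans (length-ʳ++ (iterate f x k)) (cong (_+ length ys) (length-iterate f x k))

  iterate-∷ʳ : ∀ x k → iterate f x (suc k) ≡ iterate f x k ∷ʳ fold x f k
  iterate-∷ʳ x zero    = refl
  iterate-∷ʳ x (suc k) = cong (x ∷_) (trans (iterate-∷ʳ (f x) k) (cong (iterate f (f x) k ∷ʳ_) (fold-shift x k)))

  iterate-++ : ∀ x k n → iterate f x (k + n) ≡ iterate f x k ++ iterate f (fold x f k) n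
  iterate-++ x zero    n = refl
  iterate-++ x (suc k) n = cong (x ∷_) (trans (iterate-++ (f x) k n)
    (cong (λ y → iterate f (f x) k ++ iterate f y n) (fold-shift x k)))

  iterate-split : ∀ u {v} x n → iterate f x n ≡ u ++ v →
    ∃₂ λ j k → j + k ≡ n × u ≡ iterate f x j × v ≡ iterate f (fold x f j) k
  iterate-split []      x n e = 0 , n , refl , refl , sym e
  iterate-split (y ∷ u) x (suc n) e =
    let j , k , j+k , u≡ , v≡ = iterate-split u (f x) n (proj₂ (∷-injective e))
    in suc j , k , cong suc j+k , cong₂ _∷_ (sym (proj₁ (∷-injective e))) u≡ ,
       trans v≡ (cong (λ y → iterate f y k) (fold-shift x j))

fold-inverse : {A : Set} (f g : A → A) → (∀ x → g (f x) ≡ x) → ∀ x k → fold (fold x f k) g k ≡ x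
fold-inverse f g gf x zero    = refl
fold-inverse f g gf x (suc k) =
  trans (sym (fold-shift g _ k)) (trans (cong (λ y → fold y g k) (gf _)) (fold-inverse f g gf x k))

-- φ rotates the letters leaving a vertex: l and φ l bound a face, and all
-- faces have 2m = 2 (2 + p) sides.
record RotationSystem : Set₁ where
  field
    X         : Set
    _≟_       : DecidableEquality (Letter X)
    φ ψ       : Letter X → Letter X
    p         : ℕ
    φψ        : ∀ l → φ (ψ l) ≡ l
    ψφ        : ∀ l → ψ (φ l) ≡ l
    -- Orbits of `φ` have at least four letters. This keeps a letter that continues a run from
    -- leading down or continuing the other run.
    φ²≢       : ∀ l → φ (φ l) ≢ l
    φ³≢       : ∀ l → φ (φ (φ l)) ≢ l
    period    : ∀ l → fold l (φ ∘ invLetter) ((2 + p) + (2 + p)) ≡ l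
    base      : Letter X
    reach     : ∀ l → ∃ λ k → k ≤ (2 + p) + (2 + p) × l ≡ fold base (φ ∘ invLetter) k
    index     : Fin ((2 + p) + (2 + p)) ↔ Letter X
    boundary  : Word X
    boundary≡ : boundary ≡ iterate (φ ∘ invLetter) base ((2 + p) + (2 + p))

  L : Set
  L = Letter X

  inv : L → L
  inv = invLetter

  inv-inv : ∀ l → inv (inv l) ≡ l
  inv-inv (x , pos) = refl
  inv-inv (x , neg) = refl

  m : ℕ
  m = 2 + p

  -- `σ l` follows `l` on the boundary of the face on one side of `l`, and `σ̄ l` follows it on the
  -- boundary of the face on the other side.
  σ σ⁻ σ̄ : L → L
  σ  l = φ (inv l)
  σ⁻ l = inv (ψ l)
  σ̄  l = ψ (inv l)

module Tessellation (R : RotationSystem) where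
  open RotationSystem R

  φ≢ : ∀ l → φ l ≢ l
  φ≢ l e = φ²≢ l (trans (cong φ e) e)

  φ-injective : ∀ {k l} → φ k ≡ φ l → k ≡ l
  φ-injective {k} {l} e = trans (sym (ψφ k)) (trans (cong ψ e) (ψφ l))

  inv-injective : ∀ {k l} → inv k ≡ inv l → k ≡ l
  inv-injective {k} {l} e = trans (sym (inv-inv k)) (trans (cong inv e) (inv-inv l))

  σ⁻σ : ∀ l → σ⁻ (σ l) ≡ l
  σ⁻σ l = trans (cong inv (ψφ (inv l))) (inv-inv l)

  σσ⁻ : ∀ l → σ (σ⁻ l) ≡ l
  σσ⁻ l = trans (cong φ (inv-inv (ψ l))) (φψ l)

  -- The automaton of geodesics

  -- α and β are the letters leading down (equal unless the vertex is the top of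
  -- a face); i + 1 and j + 1 are the lengths of the runs ending in inv α along
  -- σ, and in inv β along σ̄.
  record State : Set where
    constructor ⟨_,_∣_,_⟩
    field
      α : Maybe L
      i : ℕ
      β : Maybe L
      j : ℕ
  open State public

  line : L → ℕ → ℕ → State
  line l c d = ⟨ just (inv l) , c ∣ just (inv l) , d ⟩

  _≟?_ : DecidableEquality (Maybe L)
  _≟?_ = ≡-dec _≟_

  start : State
  start = ⟨ nothing , 0 ∣ nothing , 0 ⟩

  δ : State → L → State
  δ s l =
    if does (α s ≟? just (ψ l)) then
      -- The run has `i s + 1` letters, so for `i s ≡ p` the letter `l` is the last of the `m` on
      -- its side and ends at the top. The two letters down are then the last edges of both sides,
      -- each a new run of length one.
      if does (i s ℕ.≟ p) then ⟨ just (φ (inv l)) , 0 ∣ just (inv l) , 0 ⟩ else line l (suc (i s)) 0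
    else if does (β s ≟? just (φ l)) then
      if does (j s ℕ.≟ p) then ⟨ just (inv l) , 0 ∣ just (ψ (inv l)) , 0 ⟩ else line l 0 (suc (j s))
    else line l 0 0

  data Step (s : State) (l : L) : State → Set where
    plus     : α s ≡ just (ψ l) → i s ≢ p → Step s l (line l (suc (i s)) 0)
    plusTop  : α s ≡ just (ψ l) → i s ≡ p → Step s l ⟨ just (φ (inv l)) , 0 ∣ just (inv l) , 0 ⟩
    minus    : α s ≢ just (ψ l) → β s ≡ just (φ l) → j s ≢ p → Step s l (line l 0 (suc (j s)))
    minusTop : α s ≢ just (ψ l) → β s ≡ just (φ l) → j s ≡ p →
               Step s l ⟨ just (inv l) , 0 ∣ just (ψ (inv l)) , 0 ⟩
    fresh    : α s ≢ just (ψ l) → β s ≢ just (φ l) → Step s l (line l 0 0)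

  step : ∀ s l → Step s l (δ s l)
  step s l with α s ≟? just (ψ l) | β s ≟? just (φ l) | i s ℕ.≟ p | j s ℕ.≟ p
  ... | yes c₁ | _     | yes e | _     rewrite dec-true  (i s ℕ.≟ p) e = plusTop c₁ e
  ... | yes c₁ | _     | no ¬e | _     rewrite dec-false (i s ℕ.≟ p) ¬e = plus c₁ ¬e
  ... | no ¬a | yes c₂ | _     | yes e rewrite dec-true  (j s ℕ.≟ p) e = minusTop ¬a c₂ e
  ... | no ¬a | yes c₂ | _     | no ¬e rewrite dec-false (j s ℕ.≟ p) ¬e = minus ¬a c₂ ¬e
  ... | no ¬a | no ¬b | _     | _     = fresh ¬a ¬b

  -- An invariant of the reachable states: at most one of the two runs is longer than one letter.
  -- `minus` starts at two letters, so that a run of one letter is counted under `plus`.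
  data Good : State → Set where
    root  : Good start
    plus  : ∀ {c k} → k ≤ p → Good ⟨ just c , k ∣ just c , 0 ⟩
    minus : ∀ {c k} → suc k ≤ p → Good ⟨ just c , 0 ∣ just c , suc k ⟩
    top   : ∀ {c d} → c ≡ φ d → Good ⟨ just c , 0 ∣ just d , 0 ⟩

  i≤p : ∀ {s} → Good s → i s ≤ p
  i≤p root      = z≤n
  i≤p (plus e)  = e
  i≤p (minus e) = z≤n
  i≤p (top _)   = z≤n

  j≤p : ∀ {s} → Good s → j s ≤ p
  j≤p root      = z≤n
  j≤p (plus e)  = z≤n
  j≤p (minus e) = e
  j≤p (top _)   = z≤n

  δ-Good : ∀ {s} → Good s → ∀ l → Good (δ s l)
  δ-Good {s} G l with δ s l | step s l
  ... | _ | plus _ n       = plus (ℕ.≤∧≢⇒< (i≤p G) n)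
  ... | _ | plusTop _ _    = top refl
  ... | _ | minus _ _ n    = minus (ℕ.≤∧≢⇒< (j≤p G) n)
  ... | _ | minusTop _ _ _ = top (sym (φψ _))
  ... | _ | fresh _ _      = plus z≤n

  Dead : State → L → Set
  Dead s l = α s ≡ just l ⊎ β s ≡ just l

  dead? : ∀ s l → Dec (Dead s l)
  dead? s l = (α s ≟? just l) ⊎-dec (β s ≟? just l)

  -- The letter l closes a face from the right, along an edge outside the tree.
  Closing : State → L → Set
  Closing s l = β s ≡ just (φ l) × j s ≡ p

  closing? : ∀ s l → Dec (Closing s l)
  closing? s l = (β s ≟? just (φ l)) ×-dec (j s ℕ.≟ p)

  -- Otherwise `φ²` would fix `l` when one letter leads down, and `φ³` would fix it at a top. Hence
  -- the order of the tests in `δ` does not matter on good states.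
  plus⇒¬minus : ∀ {s l} → Good s → α s ≡ just (ψ l) → β s ≢ just (φ l)
  plus⇒¬minus {l = l} (plus _) refl q = φ²≢ _ (trans (cong φ (sym (just-injective q))) (φψ l))
  plus⇒¬minus {l = l} (minus _) refl q = φ²≢ _ (trans (cong φ (sym (just-injective q))) (φψ l))
  plus⇒¬minus {l = l} (top e) refl refl = φ³≢ l (trans (cong φ (sym e)) (φψ l))

  plus⇒alive : ∀ {s l} → Good s → α s ≡ just (ψ l) → ¬ Dead s l
  plus⇒alive {l = l} G refl (inj₁ q) = φ≢ l (trans (cong φ (sym (just-injective q))) (φψ l))
  plus⇒alive {l = l} (plus _) refl (inj₂ q) = φ≢ l (trans (cong φ (sym (just-injective q))) (φψ l))
  plus⇒alive {l = l} (minus _) refl (inj₂ q) = φ≢ l (trans (cong φ (sym (just-injective q))) (φψ l))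
  plus⇒alive {l = l} (top e) refl (inj₂ refl) = φ²≢ l (trans (cong φ (sym e)) (φψ l))

  minus⇒alive : ∀ {s l} → Good s → β s ≡ just (φ l) → ¬ Dead s l
  minus⇒alive {l = l} G refl (inj₂ q) = φ≢ l (just-injective q)
  minus⇒alive {l = l} (plus _) refl (inj₁ q) = φ≢ l (just-injective q)
  minus⇒alive {l = l} (minus _) refl (inj₁ q) = φ≢ l (just-injective q)
  minus⇒alive {l = l} (top e) refl (inj₁ refl) = φ²≢ l (sym e)

  step-plus : ∀ {s l} → α s ≡ just (ψ l) → i s ≢ p → δ s l ≡ line l (suc (i s)) 0
  step-plus {s} {l} c n
    rewrite dec-true (α s ≟? just (ψ l)) c | dec-false (i s ℕ.≟ p) n = refl

  step-plusTop : ∀ {s l} → α s ≡ just (ψ l) → i s ≡ p → δ s l ≡ ⟨ just (φ (inv l)) , 0 ∣ just (inv l) , 0 ⟩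
  step-plusTop {s} {l} c e
    rewrite dec-true (α s ≟? just (ψ l)) c | dec-true (i s ℕ.≟ p) e = refl

  step-minus : ∀ {s l} → Good s → β s ≡ just (φ l) → j s ≢ p → δ s l ≡ line l 0 (suc (j s))
  step-minus {s} {l} G c n
    rewrite dec-false (α s ≟? just (ψ l)) (λ q → plus⇒¬minus G q c)
          | dec-true (β s ≟? just (φ l)) c | dec-false (j s ℕ.≟ p) n = refl

  step-minusTop : ∀ {s l} → Good s → β s ≡ just (φ l) → j s ≡ p →
                  δ s l ≡ ⟨ just (inv l) , 0 ∣ just (ψ (inv l)) , 0 ⟩
  step-minusTop {s} {l} G c e
    rewrite dec-false (α s ≟? just (ψ l)) (λ q → plus⇒¬minus G q c)
          | dec-true (β s ≟? just (φ l)) c | dec-true (j s ℕ.≟ p) e = refl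

  δ-dead : ∀ s l → Dead (δ s l) (inv l)
  δ-dead s l with δ s l | step s l
  ... | _ | plus _ _       = inj₁ refl
  ... | _ | plusTop _ _    = inj₂ refl
  ... | _ | minus _ _ _    = inj₁ refl
  ... | _ | minusTop _ _ _ = inj₁ refl
  ... | _ | fresh _ _      = inj₁ refl

  -- Two consecutive letters ψ f, f both leading up make the vertex the bottom of a face.
  bottom⁺ : ∀ {s f} → ¬ Dead s (ψ f) → α (δ s f) ≡ just (inv f) × i (δ s f) ≡ 0
  bottom⁺ {s} {f} n with δ s f | step s f
  ... | _ | plus c _       = contradiction (inj₁ c) n
  ... | _ | plusTop c _    = contradiction (inj₁ c) n
  ... | _ | minus _ _ _    = refl , refl
  ... | _ | minusTop _ _ _ = refl , refl
  ... | _ | fresh _ _      = refl , refl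

  bottom⁻ : ∀ {s r} → ¬ Dead s (φ r) → β (δ s r) ≡ just (inv r) × j (δ s r) ≡ 0
  bottom⁻ {s} {r} n with δ s r | step s r
  ... | _ | plus _ _       = refl , refl
  ... | _ | plusTop _ _    = refl , refl
  ... | _ | minus _ d _    = contradiction (inj₂ d) n
  ... | _ | minusTop _ d _ = contradiction (inj₂ d) n
  ... | _ | fresh _ _      = refl , refl

  -- If `ψ f` were the letter `β` of a top, then the letter `α`, its image under `φ`, would be `f`.
  dead⇒plus : ∀ {s f} → Good s → Dead s (ψ f) → ¬ Dead s f → α s ≡ just (ψ f)
  dead⇒plus G         (inj₁ d)    n = d
  dead⇒plus (plus _)  (inj₂ d)    n = d
  dead⇒plus (minus _) (inj₂ d)    n = d
  dead⇒plus (top e)   (inj₂ refl) n = contradiction (inj₁ (cong just (trans e (φψ _)))) n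

  dead⇒minus : ∀ {s r} → Good s → Dead s (φ r) → ¬ Dead s r → β s ≡ just (φ r)
  dead⇒minus G         (inj₂ d)    n = d
  dead⇒minus (plus _)  (inj₁ d)    n = d
  dead⇒minus (minus _) (inj₁ d)    n = d
  dead⇒minus (top e)   (inj₁ refl) n = contradiction (inj₂ (cong just (sym (φ-injective e)))) n

  -- If `ψ f` led down, `f` would continue a run along `σ`, and either `i` would be positive or a
  -- top would be reached, where `α` is not `inv f`.
  bottom⁺⁻¹ : ∀ {s f} → Good s → ¬ Dead s f → α (δ s f) ≡ just (inv f) → i (δ s f) ≡ 0 → ¬ Dead s (ψ f)
  bottom⁺⁻¹ {s} {f} G n q z d with δ s f | step s f | dead⇒plus G d n
  ... | _ | plus _ _       | c = case z of λ ()
  ... | _ | plusTop _ _    | c = φ≢ _ (just-injective q)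
  ... | _ | minus e _ _    | c = e c
  ... | _ | minusTop e _ _ | c = e c
  ... | _ | fresh e _      | c = e c

  bottom⁻⁻¹ : ∀ {s r} → Good s → ¬ Dead s r → β (δ s r) ≡ just (inv r) → j (δ s r) ≡ 0 → ¬ Dead s (φ r)
  bottom⁻⁻¹ {s} {r} G n q z d with δ s r | step s r | dead⇒minus G d n
  ... | _ | plus e _       | c = plus⇒¬minus G e c
  ... | _ | plusTop e _    | c = plus⇒¬minus G e c
  ... | _ | minus _ _ _    | c = case z of λ ()
  ... | _ | minusTop _ _ _ | c = φ≢ _ (trans (cong φ (sym (just-injective q))) (φψ _))
  ... | _ | fresh _ e      | c = e c

  -- A vertex is its leftmost geodesic, stored with the last letter first.
  st : List L → State
  st []      = start
  st (l ∷ x) = δ (st x) l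

  -- Excluding the closing edges makes a path reach a top along its left side only.
  data Valid : List L → Set where
    []   : Valid []
    push : ∀ {x l} → Valid x → ¬ Dead (st x) l → ¬ Closing (st x) l → Valid (l ∷ x)

  Valid-Good : ∀ {x} → Valid x → Good (st x)
  Valid-Good []           = root
  Valid-Good (push V _ _) = δ-Good (Valid-Good V) _

  -- Right multiplication by a letter.  The edges outside the tree are those that
  -- close a face from the right.  If y is its bottom and f the first letter of its
  -- left side, then the right side is exchanged with the left one, which is
  -- appended to ρ f y because the first edge f may itself lie outside the tree.
  ρ uncross par bot : L → List L → List L
  ρ l x =
    if does (dead? (st x) l) then uncross l x
    else if does (closing? (st x) l)
      -- On a face with `2m` sides, `inv l` is opposite to the first letter of the left side, so `m`
      -- steps of `σ` lead from one to the other.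
      then iterate σ (σ (fold (inv l) σ m)) (suc p) ʳ++ par (fold (inv l) σ m) x
    else l ∷ x
  uncross l []      = []
  uncross l (h ∷ x) = if does (l ≟ inv h) then x
    else iterate σ̄ (ψ (fold l σ m)) (suc p) ʳ++ bot (fold l σ m) x
  par f []      = []
  par f (h ∷ x) = if does (j (st (h ∷ x)) ℕ.≟ 0) then ρ f x else par f x
  bot f []      = []
  -- In contrast to `par`, the letter `h` stays: this vertex ends the first edge of the left side,
  -- which may differ from the tree edge `h`, so the bottom is found by multiplying by `inv f`.
  bot f (h ∷ x) = if does (i (st (h ∷ x)) ℕ.≟ 0) then ρ (inv f) (h ∷ x) else bot f x

  ρ-push : ∀ l x → ¬ Dead (st x) l → ¬ Closing (st x) l → ρ l x ≡ l ∷ x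
  ρ-push l x d c rewrite dec-false (dead? (st x) l) d | dec-false (closing? (st x) l) c = refl

  ρ-cross : ∀ l x → ¬ Dead (st x) l → Closing (st x) l →
            ρ l x ≡ iterate σ (σ (fold (inv l) σ m)) (suc p) ʳ++ par (fold (inv l) σ m) x
  ρ-cross l x d c rewrite dec-false (dead? (st x) l) d | dec-true (closing? (st x) l) c = refl

  ρ-pop : ∀ h x → Dead (st (h ∷ x)) (inv h) → ρ (inv h) (h ∷ x) ≡ x
  ρ-pop h x d rewrite dec-true (dead? (st (h ∷ x)) (inv h)) d | dec-true (inv h ≟ inv h) refl = refl

  ρ-uncross : ∀ l h x → Dead (st (h ∷ x)) l → l ≢ inv h →
              ρ l (h ∷ x) ≡ iterate σ̄ (ψ (fold l σ m)) (suc p) ʳ++ bot (fold l σ m) x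
  ρ-uncross l h x d n rewrite dec-true (dead? (st (h ∷ x)) l) d | dec-false (l ≟ inv h) n = refl

  par-stop : ∀ f h x → j (st (h ∷ x)) ≡ 0 → par f (h ∷ x) ≡ ρ f x
  par-stop f h x e rewrite dec-true (j (st (h ∷ x)) ℕ.≟ 0) e = refl

  par-go : ∀ f h x → j (st (h ∷ x)) ≢ 0 → par f (h ∷ x) ≡ par f x
  par-go f h x e rewrite dec-false (j (st (h ∷ x)) ℕ.≟ 0) e = refl

  bot-stop : ∀ f h x → i (st (h ∷ x)) ≡ 0 → bot f (h ∷ x) ≡ ρ (inv f) (h ∷ x)
  bot-stop f h x e rewrite dec-true (i (st (h ∷ x)) ℕ.≟ 0) e = refl

  bot-go : ∀ f h x → i (st (h ∷ x)) ≢ 0 → bot f (h ∷ x) ≡ bot f x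
  bot-go f h x e rewrite dec-false (i (st (h ∷ x)) ℕ.≟ 0) e = refl

  act : List L → List L → List L
  act []      x = x
  act (l ∷ w) x = act w (ρ l x)

  act-++ : ∀ v w x → act (v ++ w) x ≡ act w (act v x)
  act-++ []      w x = refl
  act-++ (l ∷ v) w x = act-++ v w (ρ l x)

  -- Runs along the sides of a face

  φσ̄-edge : ∀ r k → inv (fold r σ̄ k) ≡ fold (inv r) σ⁻ k
  φσ̄-edge r zero    = refl
  φσ̄-edge r (suc k) = cong σ⁻ (φσ̄-edge r k)

  right-side : ∀ f k → fold (ψ f) σ̄ k ≡ inv (fold f σ⁻ (suc k))
  right-side f k = trans (sym (inv-inv _)) (cong inv (trans (φσ̄-edge (ψ f) k) (fold-shift σ⁻ f k)))

  -- Halfway round the face in either direction is the same edge, by `period`.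
  opposite : ∀ f → fold f σ m ≡ fold f σ⁻ m
  opposite f = trans (sym (fold-inverse σ σ⁻ σ⁻σ (fold f σ m) m))
    (cong (λ l → fold l σ⁻ m) (trans (sym (fold-+ f σ m)) (period f)))

  -- Each letter continues a run along `σ`, so it leads up and closes no face from the right;
  -- multiplication just appends it. The last component lets `bot` skip these letters again.
  climb⁺ : ∀ k {y f} → Valid y → α (st y) ≡ just (inv f) → i (st y) + k ≡ p →
    let z = iterate σ (σ f) k ʳ++ y in
    Valid z × α (st z) ≡ just (inv (fold f σ k)) × i (st z) ≡ p ×
    act (iterate σ (σ f) k) y ≡ z × (∀ h → bot h z ≡ bot h y)
  climb⁺ zero {y} V c e = V , c , trans (sym (ℕ.+-identityʳ _)) e , refl , λ _ → refl
  climb⁺ (suc k) {y} {f} V c e =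
    let V′ , a′ , e′ , t , d = climb⁺ k (push V alive open′) (cong α s)
                                   (trans (cong (λ s → i s + k) s) (trans (sym (ℕ.+-suc _ k)) e))
    in V′ , trans a′ (cong (just ∘ inv) (fold-shift σ f k)) , e′ ,
       trans (cong (act (iterate σ (σ (σ f)) k)) (ρ-push (σ f) y alive open′)) t ,
       λ h → trans (d h) (bot-go h (σ f) y λ z → case trans (sym (cong i s)) z of λ ())
    where
    G = Valid-Good V
    a″ : α (st y) ≡ just (ψ (σ f))
    a″ = trans c (cong just (sym (ψφ _)))
    s : st (σ f ∷ y) ≡ line (σ f) (suc (i (st y))) 0
    s = step-plus {st y} a″ λ q → ℕ.m≢1+m+n p (trans (sym e) (trans (cong (_+ suc k) q) (ℕ.+-suc p k)))
    alive : ¬ Dead (st y) (σ f)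
    alive = plus⇒alive G a″
    open′ : ¬ Closing (st y) (σ f)
    open′ (c , _) = plus⇒¬minus G a″ c

  -- A letter continuing the run along `σ̄` closes the face only when `j` is already `p`; up to
  -- there the path stays in the tree.
  climb⁻ : ∀ k {y r} → Valid y → β (st y) ≡ just (inv r) → j (st y) + k ≡ p →
    let z = iterate σ̄ (σ̄ r) k ʳ++ y in
    Valid z × β (st z) ≡ just (inv (fold r σ̄ k)) × j (st z) ≡ p ×
    act (iterate σ̄ (σ̄ r) k) y ≡ z × (∀ h → par h z ≡ par h y)
  climb⁻ zero {y} V c e = V , c , trans (sym (ℕ.+-identityʳ _)) e , refl , λ _ → refl
  climb⁻ (suc k) {y} {f} V c e =
    let V′ , a′ , e′ , t , d = climb⁻ k (push V alive open′) (cong β s)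
                                   (trans (cong (λ s → j s + k) s) (trans (sym (ℕ.+-suc _ k)) e))
    in V′ , trans a′ (cong (just ∘ inv) (fold-shift σ̄ f k)) , e′ ,
       trans (cong (act (iterate σ̄ (σ̄ (σ̄ f)) k)) (ρ-push (σ̄ f) y alive open′)) t ,
       λ h → trans (d h) (par-go h (σ̄ f) y λ z → case trans (sym (cong j s)) z of λ ())
    where
    G = Valid-Good V
    a″ : β (st y) ≡ just (φ (σ̄ f))
    a″ = trans c (cong just (sym (φψ _)))
    j≢p : j (st y) ≢ p
    j≢p q = ℕ.m≢1+m+n p (trans (sym e) (trans (cong (_+ suc k) q) (ℕ.+-suc p k)))
    s : st (σ̄ f ∷ y) ≡ line (σ̄ f) 0 (suc (j (st y)))
    s = step-minus G a″ j≢p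
    alive : ¬ Dead (st y) (σ̄ f)
    alive = minus⇒alive G a″
    open′ : ¬ Closing (st y) (σ̄ f)
    open′ (_ , c) = j≢p c

  -- Relations in the group

  open Presentation (_≡ boundary)
    using (_≈_; ≈-refl; ≈-sym; ≈-trans; ++-cong; cancel; relator; HasLength; ConeType; ConeTypesOf)
    renaming (group to Γ)
  open import Algebra.Properties.Group Γ using (∙-cancelʳ)

  ≈-reflexive : ∀ {u v} → u ≡ v → u ≈ v
  ≈-reflexive refl = ≈-refl

  cancel-inv : ∀ l → inv l ∷ l ∷ [] ≈ []
  cancel-inv l = subst (λ k → inv l ∷ k ∷ [] ≈ []) (inv-inv l) (cancel (inv l))

  -- Advancing the starting point by one edge conjugates the word by a letter, and by `reach` every
  -- letter is met on the way round from `base`.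
  face : ∀ l → iterate σ l (m + m) ≈ []
  face l with reach l
  ... | k , _ , refl = go k
    where
    go : ∀ k → iterate σ (fold base σ k) (m + m) ≈ []
    go zero    = relator (sym boundary≡)
    go (suc k) = ≈-trans (≈-reflexive (trans (iterate-∷ʳ σ (σ l′) (suc p + m))
        (cong (w ∷ʳ_) (trans (fold-shift σ l′ (suc p + m)) (period l′)))))
      (≈-trans (++-cong (≈-sym (cancel-inv l′)) (≈-refl {w ∷ʳ l′}))
      (≈-trans (++-cong (≈-refl {[ inv l′ ]}) (++-cong (go k) (≈-refl {[ l′ ]}))) (cancel-inv l′)))
      where
      l′ = fold base σ k
      w  = iterate σ (σ l′) (suc p + m)

  -- The formal inverse of a run along `σ̄` is a run along `σ`; the letters cancel from the middle
  -- outwards.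
  run-back : ∀ r k → iterate σ̄ r (suc k) ++ iterate σ (inv (fold r σ̄ k)) (suc k) ≈ []
  run-back r zero    = cancel r
  run-back r (suc k) = ≈-trans (≈-reflexive (trans (cong (_++ iterate σ (inv z) (2 + k)) (iterate-∷ʳ σ̄ r (suc k)))
      (trans (++-assoc w [ z ] (iterate σ (inv z) (2 + k)))
        (cong (λ l → w ++ z ∷ inv z ∷ iterate σ l (suc k)) (trans (cong φ (inv-inv z)) (φψ _))))))
    (≈-trans (++-cong (≈-refl {w}) (++-cong (cancel z) (≈-refl {iterate σ (inv (fold r σ̄ k)) (suc k)}))) (run-back r k))
    where
    z = fold r σ̄ (suc k)
    w = iterate σ̄ r (suc k)

  -- The second half of the boundary completes the left side to a full circuit and is the inverse of
  -- the right side.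
  two-sides : ∀ f → iterate σ f m ≈ iterate σ̄ (ψ f) m
  two-sides f = ∙-cancelʳ (iterate σ (fold f σ m) m) (iterate σ f m) (iterate σ̄ (ψ f) m)
    (≈-trans (≈-reflexive (sym (iterate-++ σ f m m))) (≈-trans (face f) (≈-sym (≈-trans
      (≈-reflexive (cong (λ l → iterate σ̄ (ψ f) m ++ iterate σ l m) t≡)) (run-back (ψ f) (suc p))))))
    where
    t≡ : fold f σ m ≡ inv (fold (ψ f) σ̄ (suc p))
    t≡ = trans (opposite f) (sym (trans (cong inv (right-side f (suc p))) (inv-inv _)))

  -- Multiplication along one edge, up or down

  word-sym : ∀ {u v l} → v ≈ u ∷ʳ l → u ≈ v ∷ʳ inv l
  word-sym {u} {v} {l} v≈ = ≈-sym (≈-trans (++-cong v≈ (≈-refl {[ inv l ]}))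
    (≈-trans (≈-reflexive (++-assoc u [ l ] [ inv l ]))
    (≈-trans (++-cong (≈-refl {u}) (cancel l)) (≈-reflexive (++-identityʳ u)))))

  reverse-ʳ++ : ∀ (w x : Word X) → reverse (w ʳ++ x) ≡ reverse x ++ w
  reverse-ʳ++ w x = trans (ʳ++-ʳ++ w) (trans (cong (x ʳ++_) (++-identityʳ w)) (ʳ++-defn x))

  -- These five facts are kept together because exchanging the sides of a face needs all of them for
  -- the first edge of its left side.
  record Up (x : List L) (l : L) : Set where
    field
      valid  : Valid (ρ l x)
      state  : st (ρ l x) ≡ δ (st x) l
      back   : ρ (inv l) (ρ l x) ≡ x
      height : length (ρ l x) ≡ suc (length x)
      word   : reverse (ρ l x) ≈ reverse x ∷ʳ l

  record Down (x : List L) (l : L) : Set where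
    field
      valid  : Valid (ρ l x)
      alive  : ¬ Dead (st (ρ l x)) (inv l)
      state  : st x ≡ δ (st (ρ l x)) (inv l)
      back   : ρ (inv l) (ρ l x) ≡ x
      height : length x ≡ suc (length (ρ l x))
      word   : reverse (ρ l x) ≈ reverse x ∷ʳ l

  -- The face with bottom y and first letters f, on the left, and ψ f, on the
  -- right; its closing edge joins u to the top v, and t leads from v to u.
  module Face {y f} (V : Valid y)
    (f-alive : ¬ Dead (st y) f) (r-alive : ¬ Dead (st y) (ψ f)) (y-up : Up y f) where
    private
      module Y = Up y-up
      G = Valid-Good V
      r = ψ f
      y₁ = ρ f y
      z = iterate σ (σ f) p ʳ++ y₁
      g = fold f σ (suc p)

    t : L
    t = fold f σ m

    u v : List L
    u = iterate σ̄ r (suc p) ʳ++ y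
    v = iterate σ (σ f) (suc p) ʳ++ y₁

    private
      -- Closing a face with `r` would require `φ r`, which is `f`, to lead down. So a right side
      -- always starts inside the tree.
      r-open : ¬ Closing (st y) r
      r-open (c , _) = f-alive (inj₂ (trans c (cong just (φψ f))))

      Vr : Valid (r ∷ y)
      Vr = push V r-alive r-open

      right : _
      right = bottom⁻ {st y} {r} (f-alive ∘ subst (Dead (st y)) (φψ f))

      left : _
      left = bottom⁺ {st y} {f} r-alive

      Cu = climb⁻ p Vr (proj₁ right) (cong (_+ p) (proj₂ right))
      Cv = climb⁺ p Y.valid (trans (cong α Y.state) (proj₁ left)) (cong (_+ p) (trans (cong i Y.state) (proj₂ left)))

      v≡ : v ≡ g ∷ z
      v≡ = trans (iterate-ʳ++ σ (σ f) p y₁) (cong (_∷ z) (fold-shift σ f p))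

      Gz = Valid-Good (proj₁ Cv)

      z-plus : α (st z) ≡ just (ψ g)
      z-plus = trans (proj₁ (proj₂ Cv)) (cong just (sym (ψφ _)))

      g-alive : ¬ Dead (st z) g
      g-alive = plus⇒alive Gz z-plus

      g-open : ¬ Closing (st z) g
      g-open (c , _) = plus⇒¬minus Gz z-plus c

      st-gz : st (g ∷ z) ≡ ⟨ just t , 0 ∣ just (inv g) , 0 ⟩
      st-gz = step-plusTop {st z} z-plus (proj₁ (proj₂ (proj₂ Cv)))

    closing-letter : fold r σ̄ (suc p) ≡ inv t
    closing-letter = trans (right-side f (suc p)) (cong inv (sym (opposite f)))

    private
      u-minus : β (st u) ≡ just (φ (inv t))
      u-minus = trans (proj₁ (proj₂ Cu)) (cong just (trans (sym (φψ _)) (cong φ closing-letter)))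

      Gu = Valid-Good (proj₁ Cu)

      inv-t : inv (inv t) ≡ t
      inv-t = inv-inv t

      f≡ : fold t σ m ≡ f
      f≡ = trans (sym (fold-+ f σ m)) (period f)

    u-valid : Valid u
    u-valid = proj₁ Cu

    u-alive : ¬ Dead (st u) (inv t)
    u-alive = minus⇒alive Gu u-minus

    u-closing : Closing (st u) (inv t)
    u-closing = u-minus , proj₁ (proj₂ (proj₂ Cu))

    v-valid : Valid v
    v-valid = subst Valid (sym v≡) (push (proj₁ Cv) g-alive g-open)

    -- `plusTop` at the end of the left side and `minusTop` at the closing edge produce the same top
    -- state.
    v-state : st v ≡ δ (st u) (inv t)
    v-state = trans (cong st v≡) (trans st-gz (sym (trans (step-minusTop Gu u-minus (proj₂ u-closing))
      (cong₂ (λ c d → ⟨ just c , 0 ∣ just d , 0 ⟩) inv-t (trans (cong ψ inv-t) (ψφ _))))))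

    v-height : length v ≡ suc (length u)
    v-height = trans (length-iterate-ʳ++ σ (σ f) (suc p) y₁) (trans (cong (suc p +_) Y.height)
      (trans (ℕ.+-suc (suc p) (length y)) (cong suc (sym (length-iterate-ʳ++ σ̄ r (suc p) y)))))

    u→v : ρ (inv t) u ≡ v
    u→v = trans (ρ-cross (inv t) u u-alive u-closing)
      (cong₂ (λ h w → iterate σ (σ h) (suc p) ʳ++ w) h≡
        (trans (cong (λ h → par h u) h≡) (trans (proj₂ (proj₂ (proj₂ (proj₂ Cu))) f) (par-stop f r y (proj₂ right)))))
      where
      h≡ : fold (inv (inv t)) σ m ≡ f
      h≡ = trans (cong (λ l → fold l σ m) inv-t) f≡

    v→u : ρ t v ≡ u
    v→u = trans (cong (ρ t) v≡) (trans (ρ-uncross t g z (inj₁ (cong α st-gz)) (φ≢ _))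
      (cong₂ (λ h w → iterate σ̄ (ψ h) (suc p) ʳ++ w) f≡
        (trans (cong (λ h → bot h z) f≡) (trans (proj₂ (proj₂ (proj₂ (proj₂ Cv))) f) (trans (stop y₁ refl) Y.back)))))
      where
      -- `bot` computes only on a nonempty list, and `y₁` is nonempty because it is higher than `y`.
      stop : ∀ w → w ≡ y₁ → bot f w ≡ ρ (inv f) y₁
      stop []      e = case trans (cong length e) Y.height of λ ()
      stop (h ∷ w) e = trans (bot-stop f h w (trans (cong (i ∘ st) e) (trans (cong i Y.state) (proj₂ left)))) (cong (ρ (inv f)) e)

    left-path : act (iterate σ f m) y ≡ v
    left-path = trans (cong (λ w → act w y₁) (iterate-∷ʳ σ (σ f) p)) (trans (act-++ (iterate σ (σ f) p) _ y₁)
      (trans (cong₂ ρ (fold-shift σ f p) (proj₁ (proj₂ (proj₂ (proj₂ Cv))))) (trans (ρ-push g z g-alive g-open) (sym v≡))))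

    right-path : act (iterate σ̄ r m) y ≡ v
    right-path = trans (cong (act (iterate σ̄ (σ̄ r) (suc p))) (ρ-push r y r-alive r-open))
      (trans (cong (λ w → act w (r ∷ y)) (iterate-∷ʳ σ̄ (σ̄ r) p)) (trans (act-++ (iterate σ̄ (σ̄ r) p) _ (r ∷ y))
      (trans (cong₂ ρ (trans (fold-shift σ̄ r p) closing-letter) (proj₁ (proj₂ (proj₂ (proj₂ Cu))))) u→v)))

    u→v-word : reverse v ≈ reverse u ∷ʳ inv t
    u→v-word = ≈-trans (≈-reflexive (reverse-ʳ++ (iterate σ (σ f) (suc p)) y₁))
      (≈-trans (++-cong Y.word (≈-refl {iterate σ (σ f) (suc p)}))
      (≈-trans (≈-reflexive (++-assoc (reverse y) [ f ] _))
      (≈-trans (++-cong (≈-refl {reverse y}) (two-sides f))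
      (≈-reflexive (trans (cong (reverse y ++_) (trans (iterate-∷ʳ σ̄ r (suc p))
          (cong (iterate σ̄ r (suc p) ∷ʳ_) closing-letter)))
        (trans (sym (++-assoc (reverse y) (iterate σ̄ r (suc p)) [ inv t ]))
        (cong (_∷ʳ inv t) (sym (reverse-ʳ++ (iterate σ̄ r (suc p)) y)))))))))

    up : Up u (inv t)
    up = record
      { valid  = subst Valid (sym u→v) v-valid
      ; state  = trans (cong st u→v) v-state
      ; back   = trans (cong₂ ρ inv-t u→v) v→u
      ; height = trans (cong length u→v) v-height
      ; word   = subst (λ x → reverse x ≈ reverse u ∷ʳ inv t) (sym u→v) u→v-word
      }

    down : Down v t
    down = record
      { valid  = subst Valid (sym v→u) u-valid
      ; alive  = subst (λ x → ¬ Dead (st x) (inv t)) (sym v→u) u-alive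
      ; state  = trans v-state (cong (λ x → δ (st x) (inv t)) (sym v→u))
      ; back   = trans (cong (ρ (inv t)) v→u) u→v
      ; height = trans v-height (cong (suc ∘ length) (sym v→u))
      ; word   = subst (λ x → reverse x ≈ reverse v ∷ʳ t) (sym v→u)
                   (subst (λ l → reverse u ≈ reverse v ∷ʳ l) (inv-inv t) (word-sym {reverse u} u→v-word))
      }

  -- The last letter of a valid path is never a `minusTop` step, so a run along `σ̄` can be read off
  -- the list back to its bottom `y`.
  shape⁻ : ∀ {x d} → Valid x → β (st x) ≡ just d → ∃₂ λ r y →
    x ≡ iterate σ̄ r (suc (j (st x))) ʳ++ y × Valid y × ¬ Dead (st y) r × ¬ Dead (st y) (φ r) ×
    d ≡ inv (fold r σ̄ (j (st x)))
  shape⁻ {h ∷ x} (push V n c) e with δ (st x) h | step (st x) h | bottom⁻⁻¹ {r = h} (Valid-Good V) n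
  shape⁻ {h ∷ x} (push V n c) refl | _ | plus _ _ | w = h , x , refl , V , n , w refl refl , refl
  shape⁻ {h ∷ x} (push V n c) refl | _ | plusTop _ _ | w = h , x , refl , V , n , w refl refl , refl
  shape⁻ {h ∷ x} (push V n c) refl | _ | minus _ q _ | w =
    let r , y , x≡ , Vy , r-alive , f-alive , b≡ = shape⁻ V q
        h≡ = trans (sym (ψφ h)) (cong ψ b≡)
    in r , y , trans (cong₂ _∷_ h≡ x≡) (sym (iterate-ʳ++ σ̄ r (suc (j (st x))) y)) ,
       Vy , r-alive , f-alive , cong inv h≡
  shape⁻ {h ∷ x} (push V n c) refl | _ | minusTop _ q r | w = contradiction (q , r) c
  shape⁻ {h ∷ x} (push V n c) refl | _ | fresh _ _ | w = h , x , refl , V , n , w refl refl , refl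

  -- The run is traced back only to the end `y` of its first edge `f`: if `y` is a top, `f` may be
  -- its closing edge and then is not the last letter of `y`.
  shape⁺ : ∀ {x c} → Valid x → α (st x) ≡ just c → ∃₂ λ f y →
    x ≡ iterate σ (σ f) (i (st x)) ʳ++ y × Valid y × α (st y) ≡ just (inv f) × i (st y) ≡ 0 ×
    c ≡ inv (fold f σ (i (st x))) × length y ≤ length x
  shape⁺ {h ∷ x} {c} V@(push V′ _ _) e = by-step refl (step (st x) h)
    where
    Shape : ℕ → Set
    Shape k = ∃₂ λ f y → h ∷ x ≡ iterate σ (σ f) k ʳ++ y × Valid y × α (st y) ≡ just (inv f) ×
      i (st y) ≡ 0 × c ≡ inv (fold f σ k) × length y ≤ suc (length x)
    stop : i (st (h ∷ x)) ≡ 0 → Shape (i (st (h ∷ x)))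
    stop z = subst Shape (sym z)
      (inv c , h ∷ x , refl , V , trans e (cong just (sym (inv-inv c))) , z , sym (inv-inv c) , ℕ.≤-refl)
    by-step : ∀ {s} → st (h ∷ x) ≡ s → Step (st x) h s → Shape (i (st (h ∷ x)))
    by-step s≡ (plusTop _ _)    = stop (cong i s≡)
    by-step s≡ (minus _ _ _)    = stop (cong i s≡)
    by-step s≡ (minusTop _ _ _) = stop (cong i s≡)
    by-step s≡ (fresh _ _)      = stop (cong i s≡)
    by-step s≡ (plus q _) =
      let f , y , x≡ , Vy , a≡ , z , b≡ , y≤x = shape⁺ V′ q
          h≡ = trans (sym (φψ h)) (cong φ b≡)
      in subst Shape (sym (cong i s≡))
        ( f , y , trans (cong₂ _∷_ (trans h≡ (sym (fold-shift σ f (i (st x))))) x≡)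
            (sym (iterate-ʳ++ σ (σ f) (i (st x)) y))
        , Vy , a≡ , z , trans (just-injective (trans (sym e) (cong α s≡))) (cong inv h≡) , ℕ.m≤n⇒m≤1+n y≤x)

  -- Induction on the height. To cross a closing edge upwards one needs the way up along `f` from
  -- the bottom of the face; to cross it downwards, the way down along `inv f` from the end of the
  -- first edge of the left side. Both start lower.
  up-below   : ∀ n {x} → length x ≤ n → Valid x → ∀ {l} → ¬ Dead (st x) l → Up x l
  down-below : ∀ n {x} → length x ≤ n → Valid x → ∀ {l} → Dead (st x) l → Down x l

  up-below n {x} x≤n V {l} l-alive with closing? (st x) l
  ... | no l-open = record
    { valid  = subst Valid (sym x→) (push V l-alive l-open)
    ; state  = cong st x→
    ; back   = trans (cong (ρ (inv l)) x→) (ρ-pop l x (δ-dead (st x) l))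
    ; height = cong length x→
    ; word   = ≈-reflexive (trans (cong reverse x→) (unfold-reverse l x))
    }
    where
    x→ = ρ-push l x l-alive l-open
  ... | yes (c , j≡p) = let r , y , x≡ , Vy , r-alive , f-alive , _ = shape⁻ V c in
    case-face n x≤n r y (trans x≡ (cong (λ k → iterate σ̄ r (suc k) ʳ++ y) j≡p)) Vy r-alive f-alive
    where
    case-face : ∀ n → length x ≤ n → ∀ r y → x ≡ iterate σ̄ r (suc p) ʳ++ y →
      Valid y → ¬ Dead (st y) r → ¬ Dead (st y) (φ r) → Up x l
    case-face zero x≤0 r y x≡ _ _ _ = case subst (_≤ 0) (trans (cong length x≡) (length-iterate-ʳ++ σ̄ r (suc p) y)) x≤0 of λ ()
    case-face (suc n) x≤n r y x≡ Vy r-alive f-alive = subst₂ Up (sym x≡u) t≡l F.up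
      where
      y≤n : length y ≤ n
      y≤n = ℕ.≤-trans (ℕ.m≤n+m (length y) p)
        (ℕ.≤-pred (subst (_≤ suc n) (trans (cong length x≡) (length-iterate-ʳ++ σ̄ r (suc p) y)) x≤n))
      module F = Face Vy f-alive (r-alive ∘ subst (Dead (st y)) (ψφ r)) (up-below n y≤n Vy f-alive)
      x≡u : x ≡ F.u
      x≡u = trans x≡ (cong (λ r → iterate σ̄ r (suc p) ʳ++ y) (sym (ψφ r)))
      t≡l : inv F.t ≡ l
      t≡l = φ-injective (just-injective (trans (sym (proj₁ F.u-closing)) (trans (cong (β ∘ st) (sym x≡u)) c)))

  down-below n       {[]} _ _ (inj₁ ())
  down-below n       {[]} _ _ (inj₂ ())
  down-below (suc n) {h ∷ x} x≤n (push V h-alive h-open) {l} l-dead with l ≟ inv h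
  ... | yes refl = record
    { valid  = subst Valid (sym x→) V
    ; alive  = subst₂ (λ x l → ¬ Dead (st x) l) (sym x→) (sym (inv-inv h)) h-alive
    ; state  = cong₂ (δ ∘ st) (sym x→) (sym (inv-inv h))
    ; back   = trans (cong₂ ρ (inv-inv h) x→) (ρ-push h x h-alive h-open)
    ; height = cong (suc ∘ length) (sym x→)
    ; word   = subst (λ w → reverse w ≈ reverse (h ∷ x) ∷ʳ inv h) (sym x→) (word-sym (≈-reflexive (unfold-reverse h x)))
    }
    where
    x→ = ρ-pop h x l-dead
  -- A letter down other than `inv h` exists only at a top, and a valid path reaches a top by
  -- `plusTop`.
  ... | no l≢ = by-step (step (st x) h) l-dead
    where
    by-face : α (st x) ≡ just (ψ h) → i (st x) ≡ p → l ≡ φ (inv h) → Down (h ∷ x) l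
    by-face c i≡p l≡ with shape⁺ V c
    ... | f , y₁ , x≡ , Vy₁ , a≡ , z , b≡ , y₁≤x = subst₂ Down (sym x≡v) t≡l F.down
      where
      D = down-below n (ℕ.≤-trans y₁≤x (ℕ.≤-pred x≤n)) Vy₁ (inj₁ a≡)
      module D = Down D
      y = ρ (inv f) y₁
      f-alive : ¬ Dead (st y) f
      f-alive = subst (λ l → ¬ Dead (st y) l) (inv-inv f) D.alive
      y₁-state : st y₁ ≡ δ (st y) f
      y₁-state = trans D.state (cong (δ (st y)) (inv-inv f))
      y→y₁ : ρ f y ≡ y₁
      y→y₁ = trans (cong (λ l → ρ l y) (sym (inv-inv f))) D.back
      -- This is the descent `D` read backwards along the same edge.
      y-up : Up y f
      y-up = record
        { valid  = subst Valid (sym y→y₁) Vy₁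
        ; state  = trans (cong st y→y₁) y₁-state
        ; back   = cong (ρ (inv f)) y→y₁
        ; height = trans (cong length y→y₁) D.height
        ; word   = subst₂ (λ w l → reverse w ≈ reverse y ∷ʳ l) (sym y→y₁) (inv-inv f) (word-sym {reverse y₁} D.word)
        }
      module F = Face D.valid f-alive
        (bottom⁺⁻¹ (Valid-Good D.valid) f-alive (trans (cong α (sym y₁-state)) a≡) (trans (cong i (sym y₁-state)) z)) y-up
      h≡ : h ≡ fold f σ (suc p)
      h≡ = trans (sym (φψ h)) (cong φ (trans b≡ (cong (λ k → inv (fold f σ k)) i≡p)))
      x≡v : h ∷ x ≡ F.v
      x≡v = trans (cong₂ _∷_ (trans h≡ (sym (fold-shift σ f p))) (trans x≡ (cong (λ k → iterate σ (σ f) k ʳ++ y₁) i≡p)))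
        (trans (sym (iterate-ʳ++ σ (σ f) p y₁)) (cong (iterate σ (σ f) (suc p) ʳ++_) (sym y→y₁)))
      t≡l : F.t ≡ l
      t≡l = trans (cong σ (sym h≡)) (sym l≡)
    by-step : ∀ {s} → Step (st x) h s → Dead s l → Down (h ∷ x) l
    by-step (plus _ _)       (inj₁ refl) = contradiction refl l≢
    by-step (plus _ _)       (inj₂ refl) = contradiction refl l≢
    by-step (plusTop c e)    (inj₁ refl) = by-face c e refl
    by-step (plusTop _ _)    (inj₂ refl) = contradiction refl l≢
    by-step (minus _ _ _)    (inj₁ refl) = contradiction refl l≢
    by-step (minus _ _ _)    (inj₂ refl) = contradiction refl l≢
    by-step (minusTop _ d e) _           = contradiction (d , e) h-open
    by-step (fresh _ _)      (inj₁ refl) = contradiction refl l≢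
    by-step (fresh _ _)      (inj₂ refl) = contradiction refl l≢

  -- The action of the group

  going-up : ∀ {x} → Valid x → ∀ {l} → ¬ Dead (st x) l → Up x l
  going-up {x} = up-below (length x) ℕ.≤-refl

  going-down : ∀ {x} → Valid x → ∀ {l} → Dead (st x) l → Down x l
  going-down {x} = down-below (length x) ℕ.≤-refl

  ρ-valid : ∀ {x} → Valid x → ∀ l → Valid (ρ l x)
  ρ-valid {x} V l with dead? (st x) l
  ... | yes d = Down.valid (going-down V d)
  ... | no ¬d = Up.valid (going-up V ¬d)

  ρ-back : ∀ {x} → Valid x → ∀ l → ρ (inv l) (ρ l x) ≡ x
  ρ-back {x} V l with dead? (st x) l
  ... | yes d = Down.back (going-down V d)
  ... | no ¬d = Up.back (going-up V ¬d)

  ρ-word : ∀ {x} → Valid x → ∀ l → reverse (ρ l x) ≈ reverse x ∷ʳ l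
  ρ-word {x} V l with dead? (st x) l
  ... | yes d = Down.word (going-down V d)
  ... | no ¬d = Up.word (going-up V ¬d)

  ρ-height : ∀ {x} → Valid x → ∀ l → length (ρ l x) ≤ suc (length x)
  ρ-height {x} V l with dead? (st x) l
  ... | yes d = ℕ.m≤n⇒m≤1+n (ℕ.<⇒≤ (ℕ.≤-reflexive (sym (Down.height (going-down V d)))))
  ... | no ¬d = ℕ.≤-reflexive (Up.height (going-up V ¬d))

  ρ-injective : ∀ {x y} → Valid x → Valid y → ∀ {l} → ρ l x ≡ ρ l y → x ≡ y
  ρ-injective V W {l} e = trans (sym (ρ-back V l)) (trans (cong (ρ (inv l)) e) (ρ-back W l))

  act-valid : ∀ {x} → Valid x → ∀ w → Valid (act w x)
  act-valid V []      = V
  act-valid V (l ∷ w) = act-valid (ρ-valid V l) w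

  act-word : ∀ {x} → Valid x → ∀ w → reverse (act w x) ≈ reverse x ++ w
  act-word {x} V []      = ≈-reflexive (sym (++-identityʳ (reverse x)))
  act-word {x} V (l ∷ w) = ≈-trans (act-word (ρ-valid V l) w)
    (≈-trans (++-cong (ρ-word V l) (≈-refl {w})) (≈-reflexive (++-assoc (reverse x) [ l ] w)))

  act-height : ∀ {x} → Valid x → ∀ w → length (act w x) ≤ length x + length w
  act-height {x} V []      = ℕ.≤-reflexive (sym (ℕ.+-identityʳ (length x)))
  act-height {x} V (l ∷ w) = ℕ.≤-trans (act-height (ρ-valid V l) w)
    (ℕ.≤-trans (ℕ.+-monoˡ-≤ (length w) (ρ-height V l)) (ℕ.≤-reflexive (sym (ℕ.+-suc (length x) (length w)))))

  act-run-back : ∀ {x} → Valid x → ∀ r k →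
    act (iterate σ (inv (fold r σ̄ k)) (suc k)) (act (iterate σ̄ r (suc k)) x) ≡ x
  act-run-back V r zero    = ρ-back V r
  act-run-back {x} V r (suc k) =
    trans (cong (act (iterate σ (inv z) (2 + k)))
      (trans (cong (λ w → act w x) (iterate-∷ʳ σ̄ r (suc k))) (act-++ w [ z ] x)))
    (trans (cong₂ (λ l y → act (iterate σ l (suc k)) y) (trans (cong φ (inv-inv z)) (φψ _)) (ρ-back (act-valid V w) z))
      (act-run-back V r k))
    where
    z = fold r σ̄ (suc k)
    w = iterate σ̄ r (suc k)

  Loop : List L → L → Set
  Loop x l = act (iterate σ l (m + m)) x ≡ x

  -- The first half of the circuit climbs the left side; its end is also the end of the right side,
  -- which the second half descends.
  bottom-loop : ∀ {y f} → Valid y → ¬ Dead (st y) f → ¬ Dead (st y) (ψ f) → Loop y f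
  bottom-loop {y} {f} V f-alive r-alive =
    trans (cong (λ w → act w y) (iterate-++ σ f m m)) (trans (act-++ (iterate σ f m) (iterate σ F.t m) y)
    (trans (cong₂ (λ l x → act (iterate σ l m) x) (trans (sym (inv-inv F.t)) (cong inv (sym F.closing-letter)))
      (trans F.left-path (sym F.right-path))) (act-run-back V (ψ f) (suc p))))
    where module F = Face V f-alive r-alive (going-up V f-alive)

  around : L → Word X
  around l = iterate σ (σ l) (suc p + m)

  around-∷ʳ : ∀ l → iterate σ (σ l) (m + m) ≡ around l ∷ʳ l
  around-∷ʳ l = trans (iterate-∷ʳ σ (σ l) (suc p + m))
    (cong (around l ∷ʳ_) (trans (fold-shift σ l (suc p + m)) (period l)))

  -- Moving the starting point along the face conjugates by one letter; `loop-back` reverses this by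
  -- the injectivity of `ρ l`.
  loop-forth : ∀ {x l} → Loop x l → Loop (ρ l x) (σ l)
  loop-forth {x} {l} e = trans (cong (λ w → act w (ρ l x)) (around-∷ʳ l))
    (trans (act-++ (around l) [ l ] (ρ l x)) (cong (ρ l) e))

  loop-back : ∀ {x l} → Valid x → Loop (ρ l x) (σ l) → Loop x l
  loop-back {x} {l} V e = ρ-injective (act-valid V (l ∷ around l)) V
    (trans (sym (act-++ (around l) [ l ] (ρ l x))) (trans (cong (λ w → act w (ρ l x)) (sym (around-∷ʳ l))) e))

  -- Unless x is the bottom of the face left of the edge l, a neighbour of x on that face is lower.
  loop : ∀ n {x} → length x ≤ n → Valid x → ∀ l → Loop x l
  loop n {x} x≤n V l with dead? (st x) l | dead? (st x) (ψ l)
  ... | no ¬d | no ¬e = bottom-loop V ¬d ¬e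
  loop zero    x≤n V l | yes d | _ = case subst (_≤ 0) (Down.height (going-down V d)) x≤n of λ ()
  loop (suc n) x≤n V l | yes d | _ =
    loop-back V (loop n (ℕ.≤-pred (subst (_≤ suc n) (Down.height D) x≤n)) (Down.valid D) (σ l))
    where D = going-down V d
  loop zero    x≤n V l | no _ | yes d = case subst (_≤ 0) (Down.height (going-down V d)) x≤n of λ ()
  loop (suc n) x≤n V l | no _ | yes d = subst₂ Loop (Down.back D) (σσ⁻ l)
    (loop-forth (loop n (ℕ.≤-pred (subst (_≤ suc n) (Down.height D) x≤n)) (Down.valid D) (σ⁻ l)))
    where D = going-down V d

  act-cong : ∀ {v w} → v ≈ w → ∀ {x} → Valid x → act v x ≡ act w x
  act-cong ≈-refl         V = refl
  act-cong (≈-sym e)      V = sym (act-cong e V)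
  act-cong (≈-trans e e′) V = trans (act-cong e V) (act-cong e′ V)
  act-cong (++-cong {u} {u′} {v} {v′} e e′) {x} V = trans (act-++ u v x)
    (trans (act-cong e′ (act-valid V u)) (trans (cong (act v′) (act-cong e V)) (sym (act-++ u′ v′ x))))
  act-cong (cancel l)     V = ρ-back V l
  act-cong (relator refl) {x} V = trans (cong (λ w → act w x) boundary≡) (loop (length x) ℕ.≤-refl V base)

  -- Normal forms and word length

  nf : Word X → List L
  nf w = act w []

  nf-valid : ∀ w → Valid (nf w)
  nf-valid = act-valid []

  nf-cong : ∀ {v w} → v ≈ w → nf v ≡ nf w
  nf-cong e = act-cong e []

  nf-word : ∀ w → reverse (nf w) ≈ w
  nf-word = act-word []

  type : Word X → State
  type w = st (nf w)

  ∣_∣ : Word X → ℕ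
  ∣ w ∣ = length (nf w)

  -- The normal form attains the minimum, since each letter of a word raises the height by at most
  -- one and equal elements end at the same vertex.
  hasLength : ∀ w → HasLength w ∣ w ∣
  hasLength w = (reverse (nf w) , nf-word w , length-reverse (nf w)) ,
    λ v e → subst (_≤ length v) (cong length (nf-cong e)) (act-height [] v)

  length-unique : ∀ {w n} → HasLength w n → n ≡ ∣ w ∣
  length-unique {w} {n} ((v , v≈w , e) , min) = ℕ.≤-antisym
    (subst (n ≤_) (length-reverse (nf w)) (min _ (nf-word w)))
    (subst (∣ w ∣ ≤_) e (proj₂ (hasLength w) v v≈w))

  -- Cone types as languages of the automaton

  cone⇒ : ∀ {x z} → ConeType x z → ∣ x ++ z ∣ ≡ ∣ x ∣ + ∣ z ∣
  cone⇒ (_ , _ , hx , hz , hxz) = trans (sym (length-unique hxz)) (cong₂ _+_ (length-unique hx) (length-unique hz))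

  cone⇐ : ∀ {x z} → ∣ x ++ z ∣ ≡ ∣ x ∣ + ∣ z ∣ → ConeType x z
  cone⇐ {x} {z} e = ∣ x ∣ , ∣ z ∣ , hasLength x , hasLength z , subst (HasLength (x ++ z)) e (hasLength (x ++ z))

  -- Closing edges lead up too and are allowed, so all geodesic continuations are accepted and not
  -- just the leftmost ones.
  data Accepts (s : State) : Word X → Set where
    []  : Accepts s []
    _∷_ : ∀ {l w} → ¬ Dead s l → Accepts (δ s l) w → Accepts s (l ∷ w)

  Accepts⇒height : ∀ {x w} → Valid x → Accepts (st x) w → length (act w x) ≡ length x + length w
  Accepts⇒height {x} V [] = sym (ℕ.+-identityʳ (length x))
  Accepts⇒height {x} V (_∷_ {l} {w} ¬d acc) = trans
    (Accepts⇒height Y.valid (subst (λ s → Accepts s w) (sym Y.state) acc))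
    (trans (cong (_+ length w) Y.height) (sym (ℕ.+-suc (length x) (length w))))
    where module Y = Up (going-up V ¬d)

  height⇒Accepts : ∀ {x} w → Valid x → length (act w x) ≡ length x + length w → Accepts (st x) w
  height⇒Accepts         []      V e = []
  height⇒Accepts {x} (l ∷ w) V e with dead? (st x) l
  ... | no ¬d = ¬d ∷ subst (λ s → Accepts s w) Y.state (height⇒Accepts w Y.valid
        (trans e (trans (ℕ.+-suc (length x) (length w)) (cong (_+ length w) (sym Y.height)))))
    where module Y = Up (going-up V ¬d)
  -- After a step down the height is two below what is required, and the remaining letters cannot
  -- make up for it.
  ... | yes d = contradiction (act-height D.valid w) (ℕ.<⇒≱ (ℕ.≤-trans
        (ℕ.≤-trans (ℕ.+-monoˡ-≤ (length w) (ℕ.≤-reflexive (sym D.height))) (ℕ.+-monoʳ-≤ (length x) (ℕ.n≤1+n (length w))))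
        (ℕ.≤-reflexive (sym e))))
    where module D = Down (going-down V d)

  ∣++∣ : ∀ x z → ∣ x ++ z ∣ ≡ length (act (reverse (nf z)) (nf x))
  ∣++∣ x z = cong length (trans (act-++ x z []) (act-cong (≈-sym (nf-word z)) (nf-valid x)))

  cone⇒Accepts : ∀ {x z} → ConeType x z → Accepts (type x) (reverse (nf z))
  cone⇒Accepts {x} {z} c = height⇒Accepts (reverse (nf z)) (nf-valid x)
    (trans (sym (∣++∣ x z)) (trans (cone⇒ {x} {z} c) (cong (∣ x ∣ +_) (sym (length-reverse (nf z))))))

  Accepts⇒cone : ∀ {x z} → Accepts (type x) (reverse (nf z)) → ConeType x z
  Accepts⇒cone {x} {z} acc = cone⇐ {x} {z} (trans (∣++∣ x z)
    (trans (Accepts⇒height (nf-valid x) acc) (cong (∣ x ∣ +_) (length-reverse (nf z)))))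

  cone-cong : ∀ {x y} → type x ≡ type y → ConeType x ≐ ConeType y
  cone-cong {x} {y} e =
    (λ {z} c → Accepts⇒cone {y} {z} (subst (λ s → Accepts s (reverse (nf z))) e (cone⇒Accepts {x} {z} c))) ,
    (λ {z} c → Accepts⇒cone {x} {z} (subst (λ s → Accepts s (reverse (nf z))) (sym e) (cone⇒Accepts {y} {z} c)))

  infix 4 _⊑_

  _⊑_ : State → State → Set
  s ⊑ t = ∀ {w} → Accepts s w → Accepts t w

  -- A shorter word for the same element would climb from `x` to the same vertex in too few steps.
  Accepts⇒geodesic : ∀ {x w} → Accepts (type x) w → ∣ w ∣ ≡ length w
  Accepts⇒geodesic {x} {w} acc = ℕ.≤-antisym (act-height [] w) (ℕ.+-cancelˡ-≤ ∣ x ∣ _ _ (begin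
    ∣ x ∣ + length w                     ≡⟨ Accepts⇒height (nf-valid x) acc ⟨
    length (act w (nf x))                ≡⟨ cong length (act-++ x w []) ⟨
    ∣ x ++ w ∣                           ≡⟨ ∣++∣ x w ⟩
    length (act (reverse (nf w)) (nf x)) ≤⟨ act-height (nf-valid x) (reverse (nf w)) ⟩
    ∣ x ∣ + length (reverse (nf w))      ≡⟨ cong (∣ x ∣ +_) (length-reverse (nf w)) ⟩
    ∣ x ∣ + ∣ w ∣                        ∎))
    where open ℕ.≤-Reasoning

  cone⊆⇒⊑ : ∀ {x y} → ConeType x ⊆ ConeType y → type x ⊑ type y
  cone⊆⇒⊑ {x} {y} sub {w} acc = height⇒Accepts w (nf-valid y) (begin
    length (act w (nf y)) ≡⟨ cong length (act-++ y w []) ⟨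
    ∣ y ++ w ∣            ≡⟨ cone⇒ {y} {w} (sub (cone⇐ {x} {w} additive)) ⟩
    ∣ y ∣ + ∣ w ∣         ≡⟨ cong (∣ y ∣ +_) geodesic ⟩
    ∣ y ∣ + length w      ∎)
    where
    open ≡-Reasoning
    geodesic = Accepts⇒geodesic {x} acc
    additive : ∣ x ++ w ∣ ≡ ∣ x ∣ + ∣ w ∣
    additive = begin
      ∣ x ++ w ∣            ≡⟨ cong length (act-++ x w []) ⟩
      length (act w (nf x)) ≡⟨ Accepts⇒height (nf-valid x) acc ⟩
      ∣ x ∣ + length w      ≡⟨ cong (∣ x ∣ +_) geodesic ⟨
      ∣ x ∣ + ∣ w ∣         ∎

  -- Distinct states accept distinct languages

  dead-⊑ : ∀ {s t l} → s ⊑ t → Dead t l → Dead s l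
  dead-⊑ {s} {t} {l} sub d with dead? s l
  ... | yes e = e
  ... | no ¬e with sub (¬e ∷ [])
  ...   | ¬d ∷ _ = contradiction d ¬d

  δ-⊑ : ∀ {s t l} → s ⊑ t → ¬ Dead s l → δ s l ⊑ δ t l
  δ-⊑ sub ¬d acc with sub (¬d ∷ acc)
  ... | _ ∷ acc′ = acc′

  -- The longer run reaches the top of its face first, where two letters lead down instead of one.
  ⊑⇒i≤ : ∀ k {s t c} → Good s → Good t → α s ≡ just c → α t ≡ just c → s ⊑ t → i t + k ≡ p → i t ≤ i s
  ⊑⇒i≤ k {s} {t} {c} S T s≡ t≡ sub e with i t ℕ.≤? i s
  ... | yes le = le
  ... | no ¬le = go k e
    where
    l = φ c
    s-plus : α s ≡ just (ψ l)
    s-plus = trans s≡ (cong just (sym (ψφ c)))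
    t-plus : α t ≡ just (ψ l)
    t-plus = trans t≡ (cong just (sym (ψφ c)))
    s-line : δ s l ≡ line l (suc (i s)) 0
    s-line = step-plus {s} s-plus (ℕ.<⇒≢ (ℕ.≤-trans (ℕ.≰⇒> ¬le) (i≤p T)))
    sub′ : δ s l ⊑ δ t l
    sub′ = δ-⊑ {s} {t} sub (plus⇒alive S s-plus)
    go : ∀ k → i t + k ≡ p → _
    go zero    e with subst (λ s → Dead s (φ (inv l))) s-line
                   (dead-⊑ {δ s l} {δ t l} sub′ (inj₁ (cong α (step-plusTop {t} t-plus (trans (sym (ℕ.+-identityʳ (i t))) e)))))
    ... | inj₁ q = contradiction (sym (just-injective q)) (φ≢ (inv l))
    ... | inj₂ q = contradiction (sym (just-injective q)) (φ≢ (inv l))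
    go (suc k) e = ℕ.≤-pred (subst₂ (λ m n → i m ≤ i n) t-line s-line
      (⊑⇒i≤ k (δ-Good S l) (δ-Good T l) (cong α s-line) (cong α t-line) sub′
        (trans (cong (λ s → i s + k) t-line) (trans (sym (ℕ.+-suc (i t) k)) e))))
      where
      t-line : δ t l ≡ line l (suc (i t)) 0
      t-line = step-plus {t} t-plus (λ q → ℕ.m≢1+m+n p (trans (sym e) (trans (cong (_+ suc k) q) (ℕ.+-suc p k))))

  -- The mirror image of `⊑⇒i≤`; the second letter down at the top is now `ψ (inv l)`.
  ⊑⇒j≤ : ∀ k {s t c} → Good s → Good t → β s ≡ just c → β t ≡ just c → s ⊑ t → j t + k ≡ p → j t ≤ j s
  ⊑⇒j≤ k {s} {t} {c} S T s≡ t≡ sub e with j t ℕ.≤? j s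
  ... | yes le = le
  ... | no ¬le = go k e
    where
    l = ψ c
    s-minus : β s ≡ just (φ l)
    s-minus = trans s≡ (cong just (sym (φψ c)))
    t-minus : β t ≡ just (φ l)
    t-minus = trans t≡ (cong just (sym (φψ c)))
    s-line : δ s l ≡ line l 0 (suc (j s))
    s-line = step-minus S s-minus (ℕ.<⇒≢ (ℕ.≤-trans (ℕ.≰⇒> ¬le) (j≤p T)))
    sub′ : δ s l ⊑ δ t l
    sub′ = δ-⊑ {s} {t} sub (minus⇒alive S s-minus)
    ψ≢ : ψ (inv l) ≢ inv l
    ψ≢ q = φ≢ (inv l) (trans (cong φ (sym q)) (φψ (inv l)))
    go : ∀ k → j t + k ≡ p → _
    go zero    e with subst (λ s → Dead s (ψ (inv l))) s-line
                   (dead-⊑ {δ s l} {δ t l} sub′ (inj₂ (cong β (step-minusTop T t-minus (trans (sym (ℕ.+-identityʳ (j t))) e)))))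
    ... | inj₁ q = contradiction (sym (just-injective q)) ψ≢
    ... | inj₂ q = contradiction (sym (just-injective q)) ψ≢
    go (suc k) e = ℕ.≤-pred (subst₂ (λ m n → j m ≤ j n) t-line s-line
      (⊑⇒j≤ k (δ-Good S l) (δ-Good T l) (cong β s-line) (cong β t-line) sub′
        (trans (cong (λ s → j s + k) t-line) (trans (sym (ℕ.+-suc (j t) k)) e))))
      where
      t-line : δ t l ≡ line l 0 (suc (j t))
      t-line = step-minus T t-minus (λ q → ℕ.m≢1+m+n p (trans (sym e) (trans (cong (_+ suc k) q) (ℕ.+-suc p k))))

  ⊑⇒i≡ : ∀ {s t c} → Good s → Good t → α s ≡ just c → α t ≡ just c → s ⊑ t → t ⊑ s → i s ≡ i t
  ⊑⇒i≡ {s} {t} S T e e′ st ts = ℕ.≤-antisym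
    (⊑⇒i≤ (p ∸ i s) T S e′ e ts (ℕ.m+[n∸m]≡n (i≤p S))) (⊑⇒i≤ (p ∸ i t) S T e e′ st (ℕ.m+[n∸m]≡n (i≤p T)))

  ⊑⇒j≡ : ∀ {s t c} → Good s → Good t → β s ≡ just c → β t ≡ just c → s ⊑ t → t ⊑ s → j s ≡ j t
  ⊑⇒j≡ {s} {t} S T e e′ st ts = ℕ.≤-antisym
    (⊑⇒j≤ (p ∸ j s) T S e′ e ts (ℕ.m+[n∸m]≡n (j≤p S))) (⊑⇒j≤ (p ∸ j t) S T e e′ st (ℕ.m+[n∸m]≡n (j≤p T)))

  -- Forgetting the bounds merges `plus` and `minus`, so that states with a single letter down are
  -- compared in one case.
  data Shape : State → Set where
    root : Shape start
    straight : ∀ c k n → Shape ⟨ just c , k ∣ just c , n ⟩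
    top  : ∀ c → Shape ⟨ just (φ c) , 0 ∣ just c , 0 ⟩

  shape : ∀ {s} → Good s → Shape s
  shape root       = root
  shape (plus _)   = straight _ _ _
  shape (minus _)  = straight _ _ _
  shape (top refl) = top _

  line-dead : ∀ {c k n l} → Dead ⟨ just c , k ∣ just c , n ⟩ l → c ≡ l
  line-dead (inj₁ refl) = refl
  line-dead (inj₂ refl) = refl

  line≢top : ∀ {c k n d} → ¬ ⟨ just c , k ∣ just c , n ⟩ ⊑ ⟨ just (φ d) , 0 ∣ just d , 0 ⟩
  line≢top {c} {k} {n} {d} sub = φ≢ d (trans
    (sym (line-dead {c} {k} {n} (dead-⊑ {s} {t} sub (inj₁ refl))))
    (line-dead {c} {k} {n} (dead-⊑ {s} {t} sub (inj₂ refl))))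
    where
    s = ⟨ just c , k ∣ just c , n ⟩
    t = ⟨ just (φ d) , 0 ∣ just d , 0 ⟩

  ⊑-antisym : ∀ {s t} → Good s → Good t → s ⊑ t → t ⊑ s → s ≡ t
  ⊑-antisym {s} {t} S T sub sup with shape S | shape T
  ... | root | root = refl
  ... | root | straight c _ _ = case dead-⊑ {s} {t} {c} sub (inj₁ refl) of λ { (inj₁ ()) ; (inj₂ ()) }
  ... | root | top c = case dead-⊑ {s} {t} {c} sub (inj₂ refl) of λ { (inj₁ ()) ; (inj₂ ()) }
  ... | straight c _ _ | root = case dead-⊑ {t} {s} {c} sup (inj₁ refl) of λ { (inj₁ ()) ; (inj₂ ()) }
  ... | top c | root = case dead-⊑ {t} {s} {c} sup (inj₂ refl) of λ { (inj₁ ()) ; (inj₂ ()) }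
  ... | straight c k n | top d = contradiction (λ {w} → sub {w}) line≢top
  ... | top d | straight c k n = contradiction (λ {w} → sup {w}) line≢top
  ... | straight c k n | straight d k′ n′ with line-dead {c} {k} {n} (dead-⊑ {s} {t} {d} sub (inj₁ refl))
  ...   | refl = cong₂ (λ k n → ⟨ just c , k ∣ just c , n ⟩) (⊑⇒i≡ S T refl refl sub sup) (⊑⇒j≡ S T refl refl sub sup)
  ⊑-antisym {s} {t} S T sub sup | top c | top d
    with dead-⊑ {s} {t} {d} sub (inj₂ refl) | dead-⊑ {s} {t} {φ d} sub (inj₁ refl)
  ... | inj₂ refl | _         = refl
  -- If the two letters down were exchanged, `φ²` would fix `c`.
  ... | inj₁ q    | inj₂ q′   = contradiction (trans (cong φ (just-injective q)) (sym (just-injective q′))) (φ²≢ c)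
  ... | inj₁ _    | inj₁ q    = cong (λ c → ⟨ just (φ c) , 0 ∣ just c , 0 ⟩) (φ-injective (just-injective q))

  -- Subwords of the relator realise all states but the initial one

  -- For a given last letter there are `p + 1` runs along `σ`, the top, and `p` runs of at least two
  -- letters along `σ̄`; the one-letter run is counted once.
  Kind : Set
  Kind = Fin (suc p) ⊎ Fin (suc p)

  σ̄⁻ : L → L
  σ̄⁻ l = inv (φ l)

  σ̄σ̄⁻ : ∀ l → σ̄ (σ̄⁻ l) ≡ l
  σ̄σ̄⁻ l = trans (cong ψ (inv-inv (φ l))) (ψφ l)

  pieceState : L × Kind → State
  pieceState (l , inj₁ k)       = line l (toℕ k) 0
  pieceState (l , inj₂ zero)    = ⟨ just (φ (inv l)) , 0 ∣ just (inv l) , 0 ⟩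
  pieceState (l , inj₂ (suc k)) = line l 0 (suc (toℕ k))

  -- Every piece ends in `l`; its first letter is found by going back along the face. Tops are
  -- represented by left sides, as by `two-sides` a right side is the same element.
  piece : L × Kind → Word X
  piece (l , inj₁ k)       = iterate σ (fold l σ⁻ (toℕ k)) (suc (toℕ k))
  piece (l , inj₂ zero)    = iterate σ (fold l σ⁻ (suc p)) m
  piece (l , inj₂ (suc k)) = iterate σ̄ (fold l σ̄⁻ (suc (toℕ k))) (2 + toℕ k)

  line-injective : ∀ {k l c d c′ d′} → line k c d ≡ line l c′ d′ → k ≡ l × c ≡ c′ × d ≡ d′
  line-injective e = inv-injective (just-injective (cong α e)) , cong i e , cong j e

  line≢ : ∀ {k l c d c′ d′} → line k c d ≢ ⟨ just (φ (inv l)) , c′ ∣ just (inv l) , d′ ⟩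
  line≢ {l = l} e = φ≢ (inv l) (just-injective (trans (sym (cong α e)) (cong β e)))

  pieceState-injective : ∀ c d → pieceState c ≡ pieceState d → c ≡ d
  pieceState-injective (l , inj₁ k) (l′ , inj₁ k′) e with line-injective e
  ... | refl , e′ , _ = cong (λ k → l , inj₁ k) (Fin.toℕ-injective e′)
  pieceState-injective (l , inj₁ k) (l′ , inj₂ zero) e = contradiction e line≢
  pieceState-injective (l , inj₁ k) (l′ , inj₂ (suc k′)) e = case line-injective e of λ { (_ , _ , ()) }
  pieceState-injective (l , inj₂ zero) (l′ , inj₁ k′) e = contradiction (sym e) line≢
  pieceState-injective (l , inj₂ zero) (l′ , inj₂ zero) e = cong (_, inj₂ zero) (inv-injective (just-injective (cong β e)))
  pieceState-injective (l , inj₂ zero) (l′ , inj₂ (suc k′)) e = contradiction (sym e) line≢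
  pieceState-injective (l , inj₂ (suc k)) (l′ , inj₁ k′) e = case line-injective e of λ { (_ , _ , ()) }
  pieceState-injective (l , inj₂ (suc k)) (l′ , inj₂ zero) e = contradiction e line≢
  pieceState-injective (l , inj₂ (suc k)) (l′ , inj₂ (suc k′)) e with line-injective e
  ... | refl , _ , e′ = cong (λ k → l , inj₂ (suc k)) (Fin.toℕ-injective (ℕ.suc-injective e′))

  pieceState-surjective : ∀ {s} → Good s → s ≢ start → ∃ λ c → pieceState c ≡ s
  pieceState-surjective root n = contradiction refl n
  pieceState-surjective (plus {c} {k} k≤p) n = (inv c , inj₁ (fromℕ< (s≤s k≤p))) ,
    cong₂ (λ c k → ⟨ just c , k ∣ just c , 0 ⟩) (inv-inv c) (Fin.toℕ-fromℕ< (s≤s k≤p))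
  pieceState-surjective (minus {c} {k} k<p) n = (inv c , inj₂ (suc (fromℕ< k<p))) ,
    cong₂ (λ c k → ⟨ just c , 0 ∣ just c , suc k ⟩) (inv-inv c) (Fin.toℕ-fromℕ< k<p)
  pieceState-surjective (top {d = d} refl) n = (inv d , inj₂ zero) ,
    cong (λ d → ⟨ just (φ d) , 0 ∣ just d , 0 ⟩) (inv-inv d)

  type-∷ʳ : ∀ w {l} → ¬ Dead (type w) l → type (w ∷ʳ l) ≡ δ (type w) l
  type-∷ʳ w {l} ¬d = trans (cong st (act-++ w [ l ] [])) (Up.state (going-up (nf-valid w) ¬d))

  type-Good : ∀ w → Good (type w)
  type-Good w = Valid-Good (nf-valid w)

  type-[_] : ∀ l → type [ l ] ≡ line l 0 0
  type-[ l ] = type-∷ʳ [] λ { (inj₁ ()) ; (inj₂ ()) }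

  module _ (l : L) (k : ℕ) (w : Word X) (e : type w ≡ line l k 0) where

    private
      c : α (type w) ≡ just (ψ (σ l))
      c = trans (cong α e) (cong just (sym (ψφ _)))

    type-σ : type (w ∷ʳ σ l) ≡ δ (type w) (σ l)
    type-σ = type-∷ʳ w (plus⇒alive (type-Good w) c)

    type-plus : k ≢ p → type (w ∷ʳ σ l) ≡ line (σ l) (suc k) 0
    type-plus n = trans type-σ (trans
      (step-plus {type w} c (n ∘ trans (sym (cong i e)))) (cong (λ k → line (σ l) (suc k) 0) (cong i e)))

    type-plusTop : k ≡ p → type (w ∷ʳ σ l) ≡ ⟨ just (φ (inv (σ l))) , 0 ∣ just (inv (σ l)) , 0 ⟩
    type-plusTop q = trans type-σ (step-plusTop {type w} c (trans (cong i e) q))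

  module _ (l : L) (k : ℕ) (w : Word X) (e : type w ≡ line l 0 k) where

    private
      c : β (type w) ≡ just (φ (σ̄ l))
      c = trans (cong β e) (cong just (sym (φψ _)))

    type-σ̄ : type (w ∷ʳ σ̄ l) ≡ δ (type w) (σ̄ l)
    type-σ̄ = type-∷ʳ w (minus⇒alive (type-Good w) c)

    type-minus : k ≢ p → type (w ∷ʳ σ̄ l) ≡ line (σ̄ l) 0 (suc k)
    type-minus n = trans type-σ̄ (trans
      (step-minus (type-Good w) c (n ∘ trans (sym (cong j e)))) (cong (λ k → line (σ̄ l) 0 (suc k)) (cong j e)))

    type-minusTop : k ≡ p → type (w ∷ʳ σ̄ l) ≡ ⟨ just (inv (σ̄ l)) , 0 ∣ just (ψ (inv (σ̄ l))) , 0 ⟩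
    type-minusTop q = trans type-σ̄ (step-minusTop (type-Good w) c (trans (cong j e) q))

  type-run⁺ : ∀ l k → k ≤ p → type (iterate σ l (suc k)) ≡ line (fold l σ k) k 0
  type-run⁺ l zero    _   = type-[ l ]
  type-run⁺ l (suc k) k<p = trans (cong type (iterate-∷ʳ σ l (suc k)))
    (type-plus (fold l σ k) k (iterate σ l (suc k)) (type-run⁺ l k (ℕ.<⇒≤ k<p)) (ℕ.<⇒≢ k<p))

  type-half⁺ : ∀ l → type (iterate σ l m) ≡ pieceState (fold l σ (suc p) , inj₂ zero)
  type-half⁺ l = trans (cong type (iterate-∷ʳ σ l (suc p)))
    (type-plusTop (fold l σ p) p (iterate σ l (suc p)) (type-run⁺ l p ℕ.≤-refl) refl)

  type-run⁻ : ∀ l k → k ≤ p → type (iterate σ̄ l (suc k)) ≡ line (fold l σ̄ k) 0 k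
  type-run⁻ l zero    _   = type-[ l ]
  type-run⁻ l (suc k) k<p = trans (cong type (iterate-∷ʳ σ̄ l (suc k)))
    (type-minus (fold l σ̄ k) k (iterate σ̄ l (suc k)) (type-run⁻ l k (ℕ.<⇒≤ k<p)) (ℕ.<⇒≢ k<p))

  type-half⁻ : ∀ l → α (type (iterate σ̄ l m)) ≡ just (inv (fold l σ̄ (suc p)))
  type-half⁻ l = trans (cong (α ∘ type) (iterate-∷ʳ σ̄ l (suc p)))
    (cong α (type-minusTop (fold l σ̄ p) p (iterate σ̄ l (suc p)) (type-run⁻ l p ℕ.≤-refl) refl))

  type-piece : ∀ c → type (piece c) ≡ pieceState c
  type-piece (l , inj₁ k)       = trans (type-run⁺ _ (toℕ k) (ℕ.≤-pred (Fin.toℕ<n k)))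
    (cong (λ l → line l (toℕ k) 0) (fold-inverse σ⁻ σ σσ⁻ l (toℕ k)))
  type-piece (l , inj₂ zero)    = trans (type-half⁺ _)
    (cong (λ l → pieceState (l , inj₂ zero)) (fold-inverse σ⁻ σ σσ⁻ l (suc p)))
  type-piece (l , inj₂ (suc k)) = trans (type-run⁻ _ (suc (toℕ k)) (Fin.toℕ<n k))
    (cong (λ l → line l 0 (suc (toℕ k))) (fold-inverse σ̄⁻ σ̄ σ̄σ̄⁻ l (suc (toℕ k))))

  -- Short subwords of the relator as runs

  ShortSubword : Pred (Word X) 0ℓ
  ShortSubword z = ∃₂ λ s c →
      s ≈ z × s ≢ [] × length s ≤ m × Subword s c
    × (CyclicPermutation boundary c ⊎ CyclicPermutation (inverse boundary) c)

  inverse-iterate : ∀ l k → inverse (iterate σ l (suc k)) ≡ iterate σ̄ (inv (fold l σ k)) (suc k)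
  inverse-iterate l zero    = refl
  inverse-iterate l (suc k) = trans (unfold-reverse (inv l) (map inv (iterate σ (σ l) (suc k))))
    (trans (cong₂ _∷ʳ_
        (trans (inverse-iterate (σ l) k) (cong (λ l → iterate σ̄ (inv l) (suc k)) (fold-shift σ l k))) (sym (back l (suc k))))
      (sym (iterate-∷ʳ σ̄ (inv (fold l σ (suc k))) (suc k))))
    where
    back : ∀ l k → fold (inv (fold l σ k)) σ̄ k ≡ inv l
    back l zero    = refl
    back l (suc k) = trans (sym (fold-shift σ̄ _ k))
      (trans (cong (λ l → fold l σ̄ k) (trans (cong ψ (inv-inv _)) (ψφ _))) (back l k))

  period⁻ : ∀ l → fold l σ̄ (m + m) ≡ l
  period⁻ l = inv-injective (trans (φσ̄-edge l (m + m))
    (trans (cong (λ l → fold l σ⁻ (m + m)) (sym (period (inv l)))) (fold-inverse σ σ⁻ σ⁻σ (inv l) (m + m))))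

  -- As `n` steps of `f` return to `l`, the moved prefix continues the run where the suffix stops.
  rotation : ∀ {f : L → L} {l} n {c} → fold l f n ≡ l → CyclicPermutation (iterate f l n) c → ∃ λ k → c ≡ iterate f k n
  rotation {f} {l} n per (u , v , e , refl) =
    let j , k , j+k , u≡ , v≡ = iterate-split f u l n e
        k+j = trans (ℕ.+-comm k j) j+k
    in fold l f j ,
       trans (cong₂ _++_ v≡ (trans u≡ (cong (λ l → iterate f l j) (trans (sym per) (trans (cong (fold l f) (sym k+j)) (fold-+ l f k))))))
         (trans (sym (iterate-++ f (fold l f j) k j)) (cong (iterate f (fold l f j)) k+j))

  infix-iterate : ∀ {f : L → L} {s l} n → Subword s (iterate f l n) → ∃₂ λ k n → s ≡ iterate f k n
  infix-iterate {f} {s} {l} n sub = go refl (toView sub)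
    where
    go : ∀ {w} → w ≡ iterate f l n → View _≡_ s w → ∃₂ λ k n → s ≡ iterate f k n
    go e (MkView pref {inf} eqs suff) =
      let j , n′ , _ , _ , e′ = iterate-split f pref l n (sym e)
          k , _ , _ , e″ , _ = iterate-split f inf (fold l f j) n′ (sym e′)
      in fold l f j , k , trans (Pointwise-≡⇒≡ eqs) e″

  type-run⁺≢start : ∀ l k → k ≤ suc p → type (iterate σ l (suc k)) ≢ start
  type-run⁺≢start l k k≤ e with ℕ.m≤n⇒m<n∨m≡n k≤
  ... | inj₁ k<p  = case trans (sym (cong α (type-run⁺ l k (ℕ.≤-pred k<p)))) (cong α e) of λ ()
  ... | inj₂ refl = case trans (sym (cong α (type-half⁺ l))) (cong α e) of λ ()

  type-run⁻≢start : ∀ l k → k ≤ suc p → type (iterate σ̄ l (suc k)) ≢ start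
  type-run⁻≢start l k k≤ e with ℕ.m≤n⇒m<n∨m≡n k≤
  ... | inj₁ k<p  = case trans (sym (cong α (type-run⁻ l k (ℕ.≤-pred k<p)))) (cong α e) of λ ()
  ... | inj₂ refl = case trans (sym (type-half⁻ l)) (cong α e) of λ ()

  inverse-boundary : ∃ λ l → inverse boundary ≡ iterate σ̄ l (m + m)
  inverse-boundary = _ , trans (cong inverse boundary≡) (inverse-iterate base (suc p + m))

  -- Such a word is a run of one to `m` letters round a face, along `σ` for the relator and along
  -- `σ̄` for its inverse, so its state has a letter down.
  short-type : ∀ {z} → ShortSubword z → type z ≢ start
  short-type {z} (s , c , s≈z , s≢[] , s≤m , sub , cyc) e = by-sign cyc
    where
    type-s : type s ≡ start
    type-s = trans (cong st (nf-cong s≈z)) e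
    by-sign : ¬ (CyclicPermutation boundary c ⊎ CyclicPermutation (inverse boundary) c)
    by-sign (inj₁ cyc) with rotation (m + m) (period base) (subst (λ w → CyclicPermutation w c) boundary≡ cyc)
    ... | l , c≡ with infix-iterate (m + m) (subst (Subword s) c≡ sub)
    ...   | k , zero , s≡  = s≢[] s≡
    ...   | k , suc n , s≡ = type-run⁺≢start k n
            (ℕ.≤-pred (subst (_≤ m) (trans (cong length s≡) (length-iterate σ k (suc n))) s≤m))
            (trans (cong type (sym s≡)) type-s)
    by-sign (inj₂ cyc) with rotation (m + m) (period⁻ (proj₁ inverse-boundary))
                              (subst (λ w → CyclicPermutation w c) (proj₂ inverse-boundary) cyc)
    ... | l , c≡ with infix-iterate (m + m) (subst (Subword s) c≡ sub)
    ...   | k , zero , s≡  = s≢[] s≡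
    ...   | k , suc n , s≡ = type-run⁻≢start k n
            (ℕ.≤-pred (subst (_≤ m) (trans (cong length s≡) (length-iterate σ̄ k (suc n))) s≤m))
            (trans (cong type (sym s≡)) type-s)

  boundary-rotation : ∀ l → CyclicPermutation boundary (iterate σ l (m + m))
  boundary-rotation l with reach l
  ... | k , k≤ , refl = iterate σ base k , iterate σ l′ n ,
    trans boundary≡ (trans (cong (iterate σ base) (sym (ℕ.m+[n∸m]≡n k≤))) (iterate-++ σ base k n)) ,
    trans (cong (iterate σ l′) (sym n+k)) (trans (iterate-++ σ l′ n k)
      (cong (λ l → iterate σ l′ n ++ iterate σ l k) (trans (sym (fold-+ base σ n)) (trans (cong (fold base σ) n+k) (period base)))))
    where
    l′ = fold base σ k
    n  = m + m ∸ k
    n+k = ℕ.m∸n+n≡m k≤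

  CyclicPermutation-inverse : ∀ {v w : Word X} → CyclicPermutation v w → CyclicPermutation (inverse v) (inverse w)
  CyclicPermutation-inverse (u , v , refl , refl) = inverse v , inverse u , inverse-++ u v , inverse-++ v u
    where
    inverse-++ : ∀ u v → inverse (u ++ v) ≡ inverse v ++ inverse u
    inverse-++ u v = trans (cong reverse (map-++ inv u v)) (reverse-++ (map inv u) (map inv v))

  inverse-boundary-rotation : ∀ l → CyclicPermutation (inverse boundary) (iterate σ̄ l (m + m))
  inverse-boundary-rotation l = subst (CyclicPermutation (inverse boundary))
    (trans (inverse-iterate l′ (suc p + m)) (cong (λ k → iterate σ̄ k (m + m)) e)) (CyclicPermutation-inverse (boundary-rotation l′))
    where
    -- The inverse of the last letter of the circuit along `σ̄` from `l`: inverting the circuit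
    -- along `σ` from `l′` gives a word that starts with `l`.
    l′ = inv (fold l σ̄ (suc p + m))
    e : inv (fold l′ σ (suc p + m)) ≡ l
    e = trans (cong inv (trans (cong (λ l → fold l σ (suc p + m)) (φσ̄-edge l (suc p + m)))
      (fold-inverse σ⁻ σ σσ⁻ (inv l) (suc p + m)))) (inv-inv l)

  initial-subword : ∀ (f : L → L) l k → k ≤ m → Subword (iterate f l k) (iterate f l (m + m))
  initial-subword f l k k≤m = subst (Subword (iterate f l k))
    (trans (sym (iterate-++ f l k (m + m ∸ k))) (cong (iterate f l) (ℕ.m+[n∸m]≡n (ℕ.≤-trans k≤m (ℕ.m≤m+n m m)))))
    (fromView (MkView [] (≡⇒Pointwise-≡ refl) (iterate f (fold l f k) (m + m ∸ k))))

  short⁺ : ∀ l k → suc k ≤ m → ShortSubword (iterate σ l (suc k))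
  short⁺ l k k≤m = _ , _ , ≈-refl , (λ ()) , subst (_≤ m) (sym (length-iterate σ l (suc k))) k≤m ,
    initial-subword σ l (suc k) k≤m , inj₁ (boundary-rotation l)

  short⁻ : ∀ l k → suc k ≤ m → ShortSubword (iterate σ̄ l (suc k))
  short⁻ l k k≤m = _ , _ , ≈-refl , (λ ()) , subst (_≤ m) (sym (length-iterate σ̄ l (suc k))) k≤m ,
    initial-subword σ̄ l (suc k) k≤m , inj₂ (inverse-boundary-rotation l)

  piece-short : ∀ c → ShortSubword (piece c)
  piece-short (l , inj₁ k)       = short⁺ _ (toℕ k) (ℕ.m≤n⇒m≤1+n (Fin.toℕ<n k))
  piece-short (l , inj₂ zero)    = short⁺ _ (suc p) ℕ.≤-refl
  piece-short (l , inj₂ (suc k)) = short⁻ _ (suc (toℕ k)) (s≤s (s≤s (ℕ.<⇒≤ (Fin.toℕ<n k))))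

  -- Counting the cone types

  cone-injective : ∀ {x y} → ConeType x ≐ ConeType y → type x ≡ type y
  cone-injective {x} {y} (sub , sup) = ⊑-antisym (type-Good x) (type-Good y) (cone⊆⇒⊑ {x} {y} sub) (cone⊆⇒⊑ {y} {x} sup)

  -- Cone types and states determine each other, so both counts reduce to comparing the states of
  -- representatives.
  cardinality : ∀ {Q : Pred (Word X) 0ℓ} {I : Set} {n} → Fin n ↔ I → (w : I → Word X) → (∀ c → Q (w c)) →
    (∀ {c d} → type (w c) ≡ type (w d) → c ≡ d) → (∀ {x} → Q x → ∃ λ c → type (w c) ≡ type x) →
    HasCardinality (ConeTypesOf Q) n
  cardinality {Q} {I} I↔ w w∈Q injective surjective = record
    { to        = λ k → ConeType (w (to k)) , w (to k) , w∈Q (to k) , ≐-refl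
    ; cong      = λ { refl → ≐-refl }
    ; bijective =
        (λ {c} {d} e → Injection.injective (Inverse⇒Injection I↔) (injective (cone-injective {w (to c)} {w (to d)} e))) ,
        λ (P , x , x∈Q , P≐) → let c , e = surjective x∈Q in
          from c , λ { refl → ≐-trans
            (cone-cong {w (to (from c))} {x} (trans (cong (type ∘ w) (strictlyInverseˡ c)) e)) (≐-sym P≐) }
    }
    where open Inverse I↔

  piece-surjective : ∀ {x} → type x ≢ start → ∃ λ c → type (piece c) ≡ type x
  piece-surjective {x} n = let c , e = pieceState-surjective (type-Good x) n in c , trans (type-piece c) e

  piece-injective : ∀ {c d} → type (piece c) ≡ type (piece d) → c ≡ d
  piece-injective {c} {d} e = pieceState-injective c d (trans (sym (type-piece c)) (trans e (type-piece d)))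

  pieces : Fin ((m + m) * (suc p + suc p)) ↔ (L × Kind)
  pieces = ↔-trans Fin.*↔× (index ×-↔ Fin.+↔⊎)

  start⇒[] : ∀ {x} → Valid x → st x ≡ start → x ≡ []
  start⇒[] [] e = refl
  start⇒[] (push {x} {l} _ _ _) e = case subst (λ s → Dead s (inv l)) e (δ-dead (st x) l) of λ { (inj₁ ()) ; (inj₂ ()) }

  cone-types :
      (∀ x → ¬ x ≈ [] → ∃ λ z → ShortSubword z × ConeType x ≐ ConeType z)
    × HasCardinality (ConeTypesOf ShortSubword) ((m + m) * (suc p + suc p))
    × HasCardinality (ConeTypesOf U) ((m + m) * (suc p + suc p) + 1)
  cone-types =
    (λ x x≉[] → let c , e = piece-surjective {x} (λ q → x≉[] (≈-trans (≈-sym (nf-word x))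
                              (≈-reflexive (cong reverse (start⇒[] (nf-valid x) q)))))
                in piece c , piece-short c , cone-cong {x} {piece c} (sym e)) ,
    cardinality pieces piece piece-short piece-injective (λ {x} x-short → piece-surjective {x} (short-type x-short)) ,
    -- The additional index stands for `start`, the state of the empty word.
    cardinality (↔-trans Fin.+↔⊎ (pieces ⊎-↔ ↔-refl)) piece₀ (λ _ → tt)
      (λ {c} {d} → piece₀-injective c d) (λ {x} _ → piece₀-surjective x)
    where
    piece₀ : (L × Kind) ⊎ Fin 1 → Word X
    piece₀ (inj₁ c) = piece c
    piece₀ (inj₂ _) = []
    piece≢start : ∀ c → type (piece c) ≢ start
    piece≢start c = short-type (piece-short c)
    piece₀-injective : ∀ c d → type (piece₀ c) ≡ type (piece₀ d) → c ≡ d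
    piece₀-injective (inj₁ c)    (inj₁ d)    e = cong inj₁ (piece-injective e)
    piece₀-injective (inj₁ c)    (inj₂ _)    e = contradiction e (piece≢start c)
    piece₀-injective (inj₂ _)    (inj₁ d)    e = contradiction (sym e) (piece≢start d)
    piece₀-injective (inj₂ zero) (inj₂ zero) e = refl
    piece₀-surjective : ∀ x → ∃ λ c → type (piece₀ c) ≡ type x
    piece₀-surjective x = by-nf (nf x) refl
      where
      by-nf : ∀ y → nf x ≡ y → ∃ λ c → type (piece₀ c) ≡ type x
      by-nf []      e = inj₂ zero , cong st (sym e)
      by-nf (_ ∷ _) e = let c , q = piece-surjective {x} λ q → case trans (sym e) (start⇒[] (nf-valid x) q) of λ ()
                        in inj₁ c , q

-- The surface relator

module _ {n : ℕ} where

  next prev : Fin (suc n) → Fin (suc n)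
  next i with view i
  ... | ‵fromℕ     = zero
  ... | ‵inject₁ k = suc k
  prev zero    = fromℕ n
  prev (suc k) = inject₁ k

  next-prev : ∀ i → next (prev i) ≡ i
  next-prev zero    rewrite view-fromℕ n = refl
  next-prev (suc k) rewrite view-inject₁ k = refl

  prev-next : ∀ i → prev (next i) ≡ i
  prev-next i with view i
  ... | ‵fromℕ     = refl
  ... | ‵inject₁ k = refl

  toℕ-next : ∀ i → toℕ i < n → toℕ (next i) ≡ suc (toℕ i)
  toℕ-next i i<n with view i
  ... | ‵fromℕ     = contradiction (Fin.toℕ-fromℕ n) (ℕ.<⇒≢ i<n)
  ... | ‵inject₁ k = cong suc (sym (Fin.toℕ-inject₁ k))

  toℕ-fold-next : ∀ k → k ≤ n → toℕ (fold zero next k) ≡ k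
  toℕ-fold-next zero    _   = refl
  toℕ-fold-next (suc k) k<n = trans (toℕ-next _ (subst (_< n) (sym e) k<n)) (cong suc e)
    where e = toℕ-fold-next k (ℕ.<⇒≤ k<n)

  fold-next : ∀ i → fold zero next (toℕ i) ≡ i
  fold-next i = Fin.toℕ-injective (toℕ-fold-next (toℕ i) (ℕ.≤-pred (Fin.toℕ<n i)))

  next-period : fold zero next (suc n) ≡ zero
  next-period = trans (cong next (Fin.toℕ-injective
    (trans (toℕ-fold-next n ℕ.≤-refl) (sym (Fin.toℕ-fromℕ n))))) (next-prev zero)

  iterate-next : iterate next zero (suc n) ≡ allFin (suc n)
  iterate-next = trans (iterate-tabulate next zero (suc n)) (tabulate-cong fold-next)
    where
    iterate-tabulate : ∀ {A : Set} (f : A → A) x k → iterate f x k ≡ tabulate {n = k} (λ i → fold x f (toℕ i))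
    iterate-tabulate f x zero    = refl
    iterate-tabulate f x (suc k) = cong (x ∷_) (trans (iterate-tabulate f (f x) k)
      (tabulate-cong (λ i → fold-shift f x (toℕ i))))

generator-≟ : ∀ {g} → DecidableEquality (Generator g)
generator-≟ (a i) (a k) = map′ (cong a) (λ { refl → refl }) (i Fin.≟ k)
generator-≟ (b i) (b k) = map′ (cong b) (λ { refl → refl }) (i Fin.≟ k)
generator-≟ (a i) (b k) = no λ ()
generator-≟ (b i) (a k) = no λ ()

letters : ∀ g → Fin (2 * g + 2 * g) ↔ Letter (Generator g)
letters g = ↔-trans (Fin.+↔⊎ {2 * g}) (↔-trans (Fin.*↔× {2} ⊎-↔ Fin.*↔× {2}) (mk↔ₛ′ to from to-from from-to))
  where
  to : Fin 2 × Fin g ⊎ Fin 2 × Fin g → Letter (Generator g)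
  to (inj₁ (zero     , i)) = a i , pos
  to (inj₁ (suc zero , i)) = a i , neg
  to (inj₂ (zero     , i)) = b i , pos
  to (inj₂ (suc zero , i)) = b i , neg
  from : Letter (Generator g) → Fin 2 × Fin g ⊎ Fin 2 × Fin g
  from (a i , pos) = inj₁ (zero     , i)
  from (a i , neg) = inj₁ (suc zero , i)
  from (b i , pos) = inj₂ (zero     , i)
  from (b i , neg) = inj₂ (suc zero , i)
  to-from : ∀ l → to (from l) ≡ l
  to-from (a i , pos) = refl
  to-from (a i , neg) = refl
  to-from (b i , pos) = refl
  to-from (b i , neg) = refl
  from-to : ∀ k → from (to k) ≡ k
  from-to (inj₁ (zero     , i)) = refl
  from-to (inj₁ (suc zero , i)) = refl
  from-to (inj₂ (zero     , i)) = refl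
  from-to (inj₂ (suc zero , i)) = refl

module Surface (n : ℕ) where

  g : ℕ
  g = 2 + n

  -- Read off the relator, in which each signed letter occurs once: `σ l` has to be the letter that
  -- cyclically follows `l`.
  φ ψ σ : Letter (Generator g) → Letter (Generator g)
  φ (a i , pos) = b i , neg
  φ (b i , neg) = a i , neg
  φ (a i , neg) = b i , pos
  φ (b i , pos) = a (next i) , pos
  ψ (b i , neg) = a i , pos
  ψ (a i , neg) = b i , neg
  ψ (b i , pos) = a i , neg
  ψ (a i , pos) = b (prev i) , pos
  σ l = φ (invLetter l)

  commutators : List (Fin g) → Word (Generator g)
  commutators is = concat (map (λ i → commutator (gen (a i)) (gen (b i))) is)

  -- Four steps of `σ` spell one commutator and arrive at the next index. With 4 as the right
  -- factor, `suc k * 4` unfolds to one such block.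
  iterate-σ : ∀ i k → iterate σ (a i , pos) (k * 4) ≡ commutators (iterate next i k)
  iterate-σ i zero    = refl
  iterate-σ i (suc k) = cong (commutators [ i ] ++_) (iterate-σ (next i) k)

  fold-σ : ∀ i k → fold (a i , pos) σ (k * 4) ≡ (a (fold i next k) , pos)
  fold-σ i zero    = refl
  fold-σ i (suc k) = cong (λ l → σ (σ (σ (σ l)))) (fold-σ i k)

  sides : 2 * g + 2 * g ≡ g * 4
  sides = lemma g
    where
    lemma : ∀ g → 2 * g + 2 * g ≡ g * 4
    lemma = solve-∀

  fold-base : ∀ i → fold (a zero , pos) σ (toℕ i * 4) ≡ (a i , pos)
  fold-base i = trans (fold-σ zero (toℕ i)) (cong (λ i → a i , pos) (fold-next i))

  position : ∀ (i : Fin g) c → c ≤ 4 → c + toℕ i * 4 ≤ 2 * g + 2 * g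
  position i c c≤4 = ℕ.≤-trans (ℕ.+-monoˡ-≤ (toℕ i * 4) c≤4)
    (ℕ.≤-trans (ℕ.*-monoˡ-≤ 4 (Fin.toℕ<n i)) (ℕ.≤-reflexive (sym sides)))

  reach : ∀ l → ∃ λ k → k ≤ 2 * g + 2 * g × l ≡ fold (a zero , pos) σ k
  reach (a i , pos) = toℕ i * 4     , position i 0 z≤n , sym (fold-base i)
  reach (b i , pos) = 1 + toℕ i * 4 , position i 1 (s≤s z≤n) , cong σ (sym (fold-base i))
  reach (a i , neg) = 2 + toℕ i * 4 , position i 2 (s≤s (s≤s z≤n)) , cong (σ ∘ σ) (sym (fold-base i))
  reach (b i , neg) = 3 + toℕ i * 4 , position i 3 (s≤s (s≤s (s≤s z≤n))) , cong (σ ∘ σ ∘ σ) (sym (fold-base i))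

  base-period : fold (a zero , pos) σ (2 * g + 2 * g) ≡ (a zero , pos)
  base-period = trans (cong (fold (a zero , pos) σ) sides)
    (trans (fold-σ zero g) (cong (λ i → a i , pos) (next-period {suc n})))

  period : ∀ l → fold l σ (2 * g + 2 * g) ≡ l
  period l with reach l
  ... | k , _ , refl = begin
    fold (fold (a zero , pos) σ k) σ (2 * g + 2 * g) ≡⟨ fold-+ (a zero , pos) σ (2 * g + 2 * g) ⟨
    fold (a zero , pos) σ (2 * g + 2 * g + k)        ≡⟨ cong (fold (a zero , pos) σ) (ℕ.+-comm (2 * g + 2 * g) k) ⟩
    fold (a zero , pos) σ (k + (2 * g + 2 * g))      ≡⟨ fold-+ (a zero , pos) σ k ⟩
    fold (fold (a zero , pos) σ (2 * g + 2 * g)) σ k ≡⟨ cong (λ l → fold l σ k) base-period ⟩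
    fold (a zero , pos) σ k                          ∎
    where open ≡-Reasoning

  surface : RotationSystem
  surface = record
    { X         = Generator g
    ; _≟_       = Product.≡-dec generator-≟ Sign._≟_
    ; φ         = φ
    ; ψ         = ψ
    -- As `g` is `2 + n`, the term `2 + p` reduces to `2 * g`, so `m` is half of the `4g` sides.
    ; p         = 2 * g ∸ 2
    ; φψ        = λ { (a i , pos) → cong (λ i → a i , pos) (next-prev i) ; (a i , neg) → refl
                    ; (b i , pos) → refl ; (b i , neg) → refl }
    ; ψφ        = λ { (a i , pos) → refl ; (a i , neg) → refl
                    ; (b i , pos) → cong (λ i → b i , pos) (prev-next i) ; (b i , neg) → refl }
    -- `φ²` changes the sign of a letter, and `φ³` exchanges the generators `a` and `b`.
    ; φ²≢       = λ { (a i , pos) () ; (a i , neg) () ; (b i , pos) () ; (b i , neg) () }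
    ; φ³≢       = λ { (a i , pos) () ; (a i , neg) () ; (b i , pos) () ; (b i , neg) () }
    ; period    = period
    ; base      = a zero , pos
    ; reach     = reach
    ; index     = letters g
    ; boundary  = surfaceRelator g
    ; boundary≡ = sym (trans (cong (iterate σ (a zero , pos)) sides)
                    (trans (iterate-σ zero g) (cong commutators iterate-next)))
    }

theorem3p7 : (g : ℕ) → 2 ≤ g →
    let open SurfaceGroup g in
    (∀ x → ¬ (x ≈ ε) → ∃ λ z → ShortRelatorSubword z × ConeType x ≐ ConeType z)
    × HasCardinality (ConeTypesOf ShortRelatorSubword) (8 * g * (2 * g ∸ 1))
    × HasCardinality (ConeTypesOf U) (8 * g * (2 * g ∸ 1) + 1)
theorem3p7 (suc (suc n)) (s≤s (s≤s z≤n)) = subst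
  (λ N → (∀ x → ¬ (x ≈ ε) → ∃ λ z → ShortRelatorSubword z × ConeType x ≐ ConeType z)
    × HasCardinality (ConeTypesOf ShortRelatorSubword) N × HasCardinality (ConeTypesOf U) (N + 1))
  -- There are `4g` letters and `2 (2g - 1)` kinds for each; `2 * (2 + n) ∸ 1` reduces to `suc p`.
  (count (2 + n) (2 * (2 + n) ∸ 1)) (Tessellation.cone-types (Surface.surface n))
  where
  open SurfaceGroup (2 + n)
  count : ∀ g k → (2 * g + 2 * g) * (k + k) ≡ 8 * g * k
  count = solve-∀
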